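{- Let $(T,D)$ be a predominated tree. (i) $(T,D)$ is MBD critical if and only if there exists a substructure $F\in\mathcal S$ in $T$ such that $D=V(T)\setminus X(F)$. (ii) $(T,D)$ is an atomic MBD critical graph if and only if $T\in\mathcal S$ and $D=V(T)\setminus X(T)$.
   Context: A predominated graph is a pair $(G,D)$ with $G$ a finite simple graph and $D\subseteq V(G)$. In the MBD game on $(G,D)$, Staller and Dominator alternately claim unclaimed vertices of $V(G)$ (including vertices of $D$), Staller first, until all are claimed; Staller wins if she claims all of $N_G[v]$ for some $v\in V(G)\setminus D$, Dominator wins otherwise. $(G,D)$ is MBD critical if Staller wins on $(G,D)$ but Dominator wins on $(G,D\cup\{v\})$ for every $v\in V(G)\setminus D$. $(G,D)$ is atomic MBD critical if it is MBD critical, $D$ is an independent set of $G$, and no vertex of $D$ is isolated in $G$. For a tree $T'$, $S(T')$ is obtained by subdividing each edge of $T'$ exactly once; $\mathcal S=\{S(T'):T'\text{ a tree}\}$ and $X(S(T'))=V(T')$ (with $S(P_1)=P_1$, $X(P_1)=V(P_1)$). $F\in\mathcal S$ is a substructure in $G$ if $F$ is a subgraph of $G$ and $\deg_G(v)=\deg_F(v)$ for all $v\in X(F)$. -}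

module Defs where

open import Data.Bool.Base using (Bool; false; T; _∨_)
open import Data.Fin.Base using (Fin; zero; suc; inject₁; fromℕ; _<_)
open import Data.Fin.Properties using (_≟_)
open import Data.Fin.Subset using (Subset; _∈_; _∉_; _∪_; ⁅_⁆; ∣_∣)
open import Data.Maybe.Base using (Maybe; just; nothing)
open import Data.Nat.Base using (ℕ; _+_)
open import Data.Product.Base using (∃; Σ-syntax; _×_; _,_; proj₁)
open import Data.Sum.Base using (_⊎_; inj₁; inj₂)
open import Data.Vec.Base using (Vec; lookup; replicate; tabulate; _[_]≔_)
open import Function.Bundles using (_⇔_; _↔_; Inverse)
open import Function.Definitions using (Injective)
open import Relation.Binary.Construct.Closure.ReflexiveTransitive using (Star)
open import Relation.Binary.PropositionalEquality.Core using (_≡_; refl)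
open import Relation.Nullary using (¬_)
open import Relation.Nullary.Decidable.Core using (⌊_⌋)

-- Simple graphs on a vertex type V; finite simple graphs are Graph (Fin n).
-- Adjacency is Boolean, so that an edge carries no further data.
record Graph (V : Set) : Set where
  field
    adj        : V → V → Bool
    adj-sym    : ∀ u v → adj u v ≡ adj v u
    adj-irrefl : ∀ v → adj v v ≡ false

  infix 4 _~_
  _~_ : V → V → Set
  u ~ v = T (adj u v)

open Graph public using (adj)

-- N_G(v), N_G[v] and deg_G(v)
N⟨_⟩ : ∀ {n} → Graph (Fin n) → Fin n → Subset n
N⟨ G ⟩ v = tabulate (adj G v)

N[_] : ∀ {n} → Graph (Fin n) → Fin n → Subset n
N[ G ] v = N⟨ G ⟩ v ∪ ⁅ v ⁆

deg : ∀ {n} → Graph (Fin n) → Fin n → ℕ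
deg G v = ∣ N⟨ G ⟩ v ∣

-- A cycle c₀ c₁ … c_{k+2} c₀ on k + 3 distinct vertices.
record Cycle {V : Set} (G : Graph V) : Set where
  open Graph G using (_~_)
  field
    {k}       : ℕ
    c         : Fin (3 + k) → V
    injective : Injective _≡_ _≡_ c
    step      : ∀ i → c (inject₁ i) ~ c (suc i)
    close     : c (fromℕ _) ~ c zero

record IsTree {V : Set} (G : Graph V) : Set where
  open Graph G using (_~_)
  field
    nonempty  : V
    connected : ∀ u v → Star _~_ u v
    acyclic   : ¬ Cycle G

record _≅_ {V W : Set} (G : Graph V) (H : Graph W) : Set where
  field
    bijection    : V ↔ W
  open Inverse bijection public using (to; from)
  field
    preserve-adj : ∀ u v → adj H (to u) (to v) ≡ adj G u v

record Subgraph {n} (G : Graph (Fin n)) : Set where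
  field
    verts    : Subset n
    -- the edge set, as a graph on all of V(G) in which the vertices
    -- outside verts are isolated
    edges    : Graph (Fin n)
    edges⊆G  : ∀ u v → T (adj edges u v) → T (adj G u v)
    endpoint : ∀ u v → T (adj edges u v) → u ∈ verts

  Vertex : Set
  Vertex = ∃ λ v → v ∈ verts

  toGraph : Graph Vertex
  toGraph = record
    { adj        = λ u v → adj edges (proj₁ u) (proj₁ v)
    ; adj-sym    = λ u v → Graph.adj-sym edges (proj₁ u) (proj₁ v)
    ; adj-irrefl = λ v → Graph.adj-irrefl edges (proj₁ v)
    }

-- Each edge {i , j} is represented once, by its ordering with i < j.
Edge : ∀ {m} → Graph (Fin m) → Set
Edge {m} G = Σ[ (i , j) ∈ Fin m × Fin m ] (i < j × T (adj G i j))

isEndpoint : ∀ {m} {G : Graph (Fin m)} → Fin m → Edge G → Bool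
isEndpoint v ((i , j) , _) = ⌊ v ≟ i ⌋ ∨ ⌊ v ≟ j ⌋

-- S(G): every edge is replaced by a path of length two through a new vertex.
subdivide : ∀ {m} (G : Graph (Fin m)) → Graph (Fin m ⊎ Edge G)
subdivide {m} G = record
  { adj = adjS ; adj-sym = symS ; adj-irrefl = irreflS }
  where
  adjS : Fin m ⊎ Edge G → Fin m ⊎ Edge G → Bool
  adjS (inj₁ _) (inj₁ _) = false
  adjS (inj₁ v) (inj₂ e) = isEndpoint {G = G} v e
  adjS (inj₂ e) (inj₁ v) = isEndpoint {G = G} v e
  adjS (inj₂ _) (inj₂ _) = false

  symS : ∀ x y → adjS x y ≡ adjS y x
  symS (inj₁ _) (inj₁ _) = refl
  symS (inj₁ _) (inj₂ _) = refl
  symS (inj₂ _) (inj₁ _) = refl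
  symS (inj₂ _) (inj₂ _) = refl

  irreflS : ∀ x → adjS x x ≡ false
  irreflS (inj₁ _) = refl
  irreflS (inj₂ _) = refl

-- H ∈ 𝒮, graphs being taken up to isomorphism.
record In𝒮 {W : Set} (H : Graph W) : Set where
  field
    {m}  : ℕ
    T′   : Graph (Fin m)
    tree : IsTree T′
    iso  : subdivide T′ ≅ H

-- X(H), the image of V(T′) in H.  It does not depend on the choice of T′ and
-- the isomorphism: it is the larger class of the bipartition of H.
X : ∀ {W : Set} {H : Graph W} → In𝒮 H → W → Set
X H∈𝒮 w = ∃ λ v → _≅_.to (In𝒮.iso H∈𝒮) (inj₁ v) ≡ w

-- For F a subgraph of G, X(F) as a set of vertices of G.
XIn : ∀ {n} {G : Graph (Fin n)} (F : Subgraph G) →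
      In𝒮 (Subgraph.toGraph F) → Fin n → Set
XIn F F∈𝒮 v = ∃ λ v∈F → X F∈𝒮 (v , v∈F)

IsSubstructure : ∀ {n} (G : Graph (Fin n)) (F : Subgraph G) →
                 In𝒮 (Subgraph.toGraph F) → Set
IsSubstructure G F F∈𝒮 =
  ∀ v → XIn F F∈𝒮 v → deg G v ≡ deg (Subgraph.edges F) v

-- D = V ∖ A
_≐V∖_ : ∀ {n} → Subset n → (Fin n → Set) → Set
D ≐V∖ A = ∀ v → v ∈ D ⇔ (¬ A v)

data Player : Set where
  staller dominator : Player

opponent : Player → Player
opponent staller   = dominator
opponent dominator = staller

module Game {n} (G : Graph (Fin n)) (D : Subset n) where

  Position : Set
  Position = Vec (Maybe Player) n

  start : Position
  start = replicate n nothing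

  Unclaimed : Position → Fin n → Set
  Unclaimed p v = lookup p v ≡ nothing

  claim : Player → Fin n → Position → Position
  claim P v p = p [ v ]≔ just P

  Over : Position → Set
  Over p = ∀ v → ¬ Unclaimed p v

  StallerClaimsNbhd : Position → Set
  StallerClaimsNbhd p =
    ∃ λ v → v ∉ D × (∀ u → u ∈ N[ G ] v → lookup p u ≡ just staller)

  Won : Player → Position → Set
  Won staller   p = StallerClaimsNbhd p
  Won dominator p = ¬ StallerClaimsNbhd p

  -- Winning strategies for P from position p, when P is to move
  -- and when the opponent is to move.
  data WinsMoving  (P : Player) (p : Position) : Set
  data WinsWaiting (P : Player) (p : Position) : Set

  data WinsMoving P p where
    over : Over p → Won P p → WinsMoving P p
    move : ∀ v → Unclaimed p v → WinsWaiting P (claim P v p) → WinsMoving P p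

  data WinsWaiting P p where
    over  : Over p → Won P p → WinsWaiting P p
    reply : ∃ (Unclaimed p) →
            (∀ v → Unclaimed p v → WinsMoving P (claim (opponent P) v p)) →
            WinsWaiting P p

StallerWins : ∀ {n} → Graph (Fin n) → Subset n → Set
StallerWins G D = WinsMoving staller start
  where open Game G D

DominatorWins : ∀ {n} → Graph (Fin n) → Subset n → Set
DominatorWins G D = WinsWaiting dominator start
  where open Game G D

MBDCritical : ∀ {n} → Graph (Fin n) → Subset n → Set
MBDCritical G D =
  StallerWins G D × (∀ v → v ∉ D → DominatorWins G (D ∪ ⁅ v ⁆))

Independent : ∀ {n} → Graph (Fin n) → Subset n → Set
Independent G D = ∀ u v → u ∈ D → v ∈ D → ¬ T (adj G u v)

Isolated : ∀ {n} → Graph (Fin n) → Fin n → Set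
Isolated G v = ∀ u → ¬ T (adj G v u)

AtomicMBDCritical : ∀ {n} → Graph (Fin n) → Subset n → Set
AtomicMBDCritical G D =
  MBDCritical G D × Independent G D × (∀ v → v ∈ D → ¬ Isolated G v)

{-# OPTIONS --safe #-}
module Submission where

-- Write A = V ∖ D.  Call A a skeleton if it is nonempty and independent, every neighbour of A
-- has exactly two neighbours in A, and any two vertices of A are joined by steps between vertices
-- with a common neighbour; these are exactly the sets X(F) of the substructures F ∈ 𝒮.  In a
-- forest either some matching covers A, and then Dominator wins by answering in the matched
-- vertex, or A contains a skeleton B, and then Staller wins: she claims the parent s of a deepest
-- vertex x ∈ B, which forces Dominator to take x, and goes on with B ∖ {x}.  As no skeleton
-- properly contains another one, (T , D) is critical iff A itself is a skeleton.

open import Defs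
open import Data.Bool.Base using (Bool; true; false; T; _∧_; _∨_)
open import Data.Bool.Properties using (T?; T-≡; T-∧; T-irrelevant; ∨-comm)
open import Data.Empty using (⊥; ⊥-elim)
open import Data.Fin.Base using (Fin; zero; suc; inject₁; fromℕ; toℕ)
import Data.Fin.Properties as Fin
open import Data.Fin.Properties using (_≟_; any?; all?; pigeonhole; toℕ-inject₁; toℕ-fromℕ; toℕ<n)
open import Data.Fin.Relation.Unary.Top using (View; view; ‵fromℕ; ‵inject₁)
open import Data.Fin.Subset using (Subset; _∈_; _∉_; _∪_; ⁅_⁆; ∣_∣; _-_; ⊤)
open import Data.Fin.Subset.Properties
  using (_∈?_; x∈p∧x≢y⇒x∈p-y; x∈p⇒∣p-x∣<∣p∣; ∈⊤; x∈p∪q⁻; x∈p∪q⁺; x∈⁅x⁆; x∈⁅y⁆⇒x≡y; p⊂q⇒∣p∣<∣q∣)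
open import Data.Maybe.Base using (Maybe; just; nothing)
open import Data.Nat.Base using (ℕ; zero; suc; _+_; _∸_; _≤_; _<_; s≤s; _⊔_)
open import Data.Nat.Induction using (Acc; acc; <-wellFounded)
import Data.Nat.Properties as ℕ
open import Data.Nat.Properties
  using (≤-refl; ≤-trans; ≤-reflexive; <-irrefl; <-trans; n<1+n; n≤1+n; m≤m⊔n; m≤n⊔m;
    suc-injective; ≰⇒>; <⇒≤; +-assoc; m∸n+n≡m; m∸n≤m; m<n⇒0<n∸m; +-suc; m≤n⇒m≤1+n)
open import Data.Product.Base using (Σ-syntax; ∃; ∃₂; _×_; _,_; proj₁; proj₂)
import Data.Sum.Base as Sum
open import Data.Sum.Base using (_⊎_; inj₁; inj₂; [_,_]′; swap)
open import Data.Unit.Base using (tt)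
open import Data.Vec.Base using (Vec; []; _∷_; lookup; tabulate; _[_]≔_)
open import Data.Vec.Functional using (updateAt)
open import Data.Vec.Functional.Properties using (updateAt-updates; updateAt-minimal)
open import Data.Vec.Properties
  using (lookup∘update; lookup∘update′; lookup-replicate; lookup⇒[]=; []=⇒lookup;
    lookup∘tabulate; tabulate-cong)
open import Data.Vec.Properties.WithK using ([]=-irrelevant)
open import Function.Base using (_∘_; const; case_of_)
open import Function.Bundles using (_⇔_; mk⇔; _↔_; mk⤖; mk↔ₛ′; Injection; Equivalence; Inverse)
open import Function.Construct.Composition using (_↔-∘_)
open import Function.Properties.Bijection using (⤖⇒↔)
open import Function.Properties.Inverse using (↔⇒↣; ↔-sym)
import Relation.Binary.Construct.Closure.ReflexiveTransitive as Star
open import Relation.Binary.Construct.Closure.ReflexiveTransitive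
  using (Star; ε; _◅_; _◅◅_; reverse; gmap)
open import Relation.Binary.Definitions using (tri<; tri≈; tri>)
open import Relation.Binary.PropositionalEquality
  using (_≡_; _≢_; refl; sym; trans; cong; cong₂; subst; subst₂)
open import Relation.Nullary using (¬_; Dec; yes; no; contradiction)
open import Relation.Nullary.Decidable
  using (_×-dec_; _⊎-dec_; ¬?; map′; decidable-stable; ⌊_⌋; toWitness; fromWitness)
open import Relation.Unary using (Decidable)

-- Both sides of the dichotomy come from one greedy rule. Working upwards from the leaves, a vertex
-- of `A` can be forced to be matched with its parent: this happens when each of its children is
-- already needed by one of that child's own children. Forced edges clash in only two ways: a forced
-- vertex has no parent, or two forced vertices are siblings. Below either clash, keeping a single
-- forced vertex under each child of a kept vertex leaves every neighbour with exactly two kept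
-- vertices around it, and this is a skeleton. Without a clash, the vertices that no forced edge
-- touches are matched greedily downwards. The rooting is only a depth function with unique parents,
-- so these arguments compare levels instead of handling paths. The dichotomy gives an explicit
-- strategy to one of the players; playing two strategies against each other shows that the other
-- player has none.

private
  variable
    n : ℕ

-- Decidability, maxima and choice over `Fin n`.

Σ-dec : ∀ {a b} {P : Set a} {Q : Set b} → Dec P → (P → Dec Q) → Dec (P × Q)
Σ-dec (no ¬p) _ = no (¬p ∘ proj₁)
Σ-dec (yes p) q? = map′ (p ,_) proj₂ (q? p)

Π-dec : ∀ {a b} {P : Set a} {Q : Set b} → Dec P → (P → Dec Q) → Dec (P → Q)
Π-dec (no ¬p) _ = yes (λ p → contradiction p ¬p)
Π-dec (yes p) q? = map′ const (λ f → f p) (q? p)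

argmax : {P : Fin n → Set} → Decidable P → (f : Fin n → ℕ) → ∃ P →
         ∃ λ x → P x × (∀ y → P y → f y ≤ f x)
argmax {n = suc n} {P} P? f (v , pv) with any? (P? ∘ suc)
... | no ¬tail = zero , at-zero v pv , bound
  where
  at-zero : ∀ w → P w → P zero
  at-zero zero    pw = pw
  at-zero (suc w) pw = contradiction (w , pw) ¬tail
  bound : ∀ y → P y → f y ≤ f zero
  bound zero    _  = ≤-refl
  bound (suc y) py = contradiction (y , py) ¬tail
... | yes tail with argmax (P? ∘ suc) (f ∘ suc) tail
...   | x , px , max with P? zero ×-dec (f (suc x) ℕ.≤? f zero)
...     | yes (p0 , x≤0) = zero , p0 , λ where
            zero    _  → ≤-refl
            (suc y) py → ≤-trans (max y py) x≤0
...     | no ¬0 = suc x , px , λ where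
            zero    p0 → <⇒≤ (≰⇒> (λ x≤0 → ¬0 (p0 , x≤0)))
            (suc y) py → max y py

bounded : (f : Fin n → ℕ) → ∃ λ b → ∀ v → f v ≤ b
bounded {n = zero}  f = 0 , λ ()
bounded {n = suc n} f with bounded (f ∘ suc)
... | b , f≤b = f zero ⊔ b , λ where
  zero    → m≤m⊔n (f zero) b
  (suc v) → ≤-trans (f≤b v) (m≤n⊔m (f zero) b)

-- Total, with a dummy value if there is no witness: the choice depends on the predicate and the
-- default alone, not on a proof, so a vertex reached in two ways gets the same `heir` or
-- `favourite`.
choose : {P : Fin n → Set} → Decidable P → Fin n → Fin n
choose P? default with any? P?
... | yes (v , _) = v
... | no  _       = default

choose-satisfies : {P : Fin n → Set} (P? : Decidable P) (default : Fin n) →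
                   ∃ P → P (choose P? default)
choose-satisfies P? default ex with any? P?
... | yes (_ , pv) = pv
... | no  ¬ex      = contradiction ex ¬ex

-- Acyclic graphs

module GraphProperties {V : Set} (G : Graph V) where
  open Graph G public using (_~_)

  ~-sym : ∀ {u v} → u ~ v → v ~ u
  ~-sym {u} {v} = subst T (Graph.adj-sym G u v)

  ~-irrefl : ∀ {v} → ¬ v ~ v
  ~-irrefl {v} = subst T (Graph.adj-irrefl G v)

  _~?_ : ∀ u v → Dec (u ~ v)
  u ~? v = T? (adj G u v)

module _ (G : Graph (Fin n)) where
  open GraphProperties G

  module NonBacktracking (w : ℕ → Fin n) (step : ∀ i → w i ~ w (suc i))
                         (turn : ∀ i → w i ≢ w (2 + i)) where

    -- A shortest closed segment has no inner repetition.
    closed-segment⇒cycle : ∀ g → Acc _<_ g → ∀ i → 0 < g → w i ≡ w (g + i) → Cycle G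
    closed-segment⇒cycle 1 _ i _ eq =
      contradiction (subst (w i ~_) (sym eq) (step i)) ~-irrefl
    closed-segment⇒cycle 2 _ i _ eq = contradiction eq (turn i)
    closed-segment⇒cycle g@(suc (suc (suc k))) (acc rec) i _ eq
      with any? (λ (a : Fin g) → any? (λ (b : Fin g) →
             (a Fin.<? b) ×-dec (w (toℕ a + i) ≟ w (toℕ b + i))))
    ... | yes (a , b , a<b , same) =
      closed-segment⇒cycle (toℕ b ∸ toℕ a) (rec gap<g) (toℕ a + i) (m<n⇒0<n∸m a<b)
        (trans same (cong w shift))
      where
      gap<g : toℕ b ∸ toℕ a < g
      gap<g = ℕ.≤-<-trans (m∸n≤m (toℕ b) (toℕ a)) (toℕ<n b)
      shift : toℕ b + i ≡ toℕ b ∸ toℕ a + (toℕ a + i)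
      shift = trans (cong (_+ i) (sym (m∸n+n≡m (<⇒≤ a<b)))) (+-assoc (toℕ b ∸ toℕ a) (toℕ a) i)
    ... | no distinct = record
      { c         = λ a → w (toℕ a + i)
      ; injective = inj
      ; step      = λ a → subst (λ j → w (j + i) ~ w (suc (toℕ a) + i))
                            (sym (toℕ-inject₁ a)) (step (toℕ a + i))
      ; close     = subst₂ (λ j v → w (j + i) ~ v) (sym (toℕ-fromℕ (2 + k))) (sym eq)
                      (step (2 + k + i))
      }
      where
      inj : ∀ {a b} → w (toℕ a + i) ≡ w (toℕ b + i) → a ≡ b
      inj {a} {b} same with Fin.<-cmp a b
      ... | tri< a<b _ _ = contradiction (a , b , a<b , same) distinct
      ... | tri≈ _ a≡b _ = a≡b
      ... | tri> _ _ b<a = contradiction (b , a , b<a , sym same) distinct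

    nonBacktracking⇒cycle : Cycle G
    nonBacktracking⇒cycle with pigeonhole (n<1+n n) (w ∘ toℕ)
    ... | i , j , i<j , same =
      closed-segment⇒cycle (toℕ j ∸ toℕ i) (<-wellFounded _) (toℕ i) (m<n⇒0<n∸m i<j)
        (trans same (cong w (sym (m∸n+n≡m (<⇒≤ i<j)))))

  -- If every vertex of `S` had, for each `p`, a neighbour in `S` other than `p`, a walk in `S`
  -- could go on forever without turning back. As `p` is arbitrary and need not be a neighbour,
  -- isolated vertices count as leaves.
  leaf : ¬ Cycle G → (S : Subset n) → ∃ (_∈ S) →
         ∃ λ v → v ∈ S × ∃ λ p → ∀ u → u ∈ S → v ~ u → u ≡ p
  leaf acyclic S (x , x∈S) with
    any? (λ v → (v ∈? S) ×-dec any? (λ p → ¬? (any? (λ u →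
      (u ∈? S) ×-dec (v ~? u) ×-dec ¬? (u ≟ p)))))
  ... | yes (v , v∈S , p , none) =
    v , v∈S , p , λ u u∈S v~u → decidable-stable (u ≟ p) (λ u≢p → none (u , u∈S , v~u , u≢p))
  ... | no ¬leaf = contradiction (NonBacktracking.nonBacktracking⇒cycle cur walk-step turn) acyclic
    where
    next : ∀ v p → v ∈ S → ∃ λ u → u ∈ S × v ~ u × u ≢ p
    next v p v∈S = decidable-stable
      (any? (λ u → (u ∈? S) ×-dec (v ~? u) ×-dec ¬? (u ≟ p)))
      (λ none → ¬leaf (v , v∈S , p , none))

    walk : ℕ → Fin n × Σ[ v ∈ Fin n ] v ∈ S
    walk zero = x , x , x∈S
    walk (suc i) with walk i
    ... | p , v , v∈S with next v p v∈S
    ...   | u , u∈S , _ = v , u , u∈S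

    cur : ℕ → Fin n
    cur i = proj₁ (proj₂ (walk i))

    walk-step : ∀ i → cur i ~ cur (suc i)
    walk-step i with walk i
    ... | p , v , v∈S with next v p v∈S
    ...   | u , _ , v~u , _ = v~u

    turn : ∀ i → cur i ≢ cur (2 + i)
    turn i with walk i
    ... | p , v , v∈S with next v p v∈S
    ...   | u , u∈S , _ with next u v u∈S
    ...     | u′ , _ , _ , u′≢v = λ v≡u′ → u′≢v (sym v≡u′)

  -- A rooting expressed by local conditions only. It is relative to `S` so that it can be built by
  -- deleting leaves. Roots of different components may have different, nonzero depths.
  record DepthOn (S : Subset n) : Set where
    field
      depth         : Fin n → ℕ
      adjacent      : ∀ {u v} → u ∈ S → v ∈ S → u ~ v →
                      depth v ≡ suc (depth u) ⊎ depth u ≡ suc (depth v)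
      unique-parent : ∀ {u u′ v} → u ∈ S → u′ ∈ S → v ∈ S → u ~ v → u′ ~ v →
                      depth v ≡ suc (depth u) → depth v ≡ suc (depth u′) → u ≡ u′

  -- A leaf v with only neighbour p is hung below p.
  depthOn : ¬ Cycle G → ∀ S → Acc _<_ ∣ S ∣ → DepthOn S
  depthOn acyclic S (acc rec) with any? (_∈? S)
  ... | no empty = record
    { depth         = const 0
    ; adjacent      = λ u∈S _ _ → contradiction (_ , u∈S) empty
    ; unique-parent = λ u∈S _ _ _ _ _ _ → contradiction (_ , u∈S) empty
    }
  ... | yes nonempty with leaf acyclic S nonempty
  ...   | v , v∈S , p , only-p = record
    { depth = d′ ; adjacent = adjacent′ ; unique-parent = unique′ }
    where
    open DepthOn (depthOn acyclic (S - v) (rec (x∈p⇒∣p-x∣<∣p∣ v∈S)))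
    d′ : Fin n → ℕ
    d′ = updateAt depth v (const (suc (depth p)))
    d′-new : d′ v ≡ suc (depth p)
    d′-new = updateAt-updates v depth
    d′-old : ∀ {u} → u ≢ v → d′ u ≡ depth u
    d′-old {u} = updateAt-minimal u v depth
    hung : ∀ {u} → u ∈ S → v ~ u → d′ v ≡ suc (d′ u)
    hung {u} u∈S v~u = trans d′-new (cong suc (sym (trans (d′-old u≢v) (cong depth u≡p))))
      where
      u≡p = only-p u u∈S v~u
      u≢v : u ≢ v
      u≢v refl = ~-irrefl v~u
    old : ∀ {u} → u ∈ S → u ≢ v → u ∈ S - v
    old = x∈p∧x≢y⇒x∈p-y
    adjacent′ : ∀ {u w} → u ∈ S → w ∈ S → u ~ w → d′ w ≡ suc (d′ u) ⊎ d′ u ≡ suc (d′ w)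
    adjacent′ {u} {w} u∈S w∈S u~w with u ≟ v | w ≟ v
    ... | yes refl | _        = inj₂ (hung w∈S u~w)
    ... | no _     | yes refl = inj₁ (hung u∈S (~-sym u~w))
    ... | no u≢v   | no w≢v   rewrite d′-old u≢v | d′-old w≢v =
      adjacent (old u∈S u≢v) (old w∈S w≢v) u~w
    not-below-leaf : ∀ {w} → w ∈ S → v ~ w → d′ w ≢ suc (d′ v)
    not-below-leaf w∈S v~w eq = ℕ.<-asym
      (≤-reflexive (sym eq)) (≤-reflexive (sym (hung w∈S v~w)))
    unique′ : ∀ {u u′ w} → u ∈ S → u′ ∈ S → w ∈ S → u ~ w → u′ ~ w →
              d′ w ≡ suc (d′ u) → d′ w ≡ suc (d′ u′) → u ≡ u′
    unique′ {u} {u′} {w} u∈S u′∈S w∈S u~w u′~w e e′ with w ≟ v | u ≟ v | u′ ≟ v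
    ... | yes refl | _ | _ =
      trans (only-p u u∈S (~-sym u~w)) (sym (only-p u′ u′∈S (~-sym u′~w)))
    ... | no _ | yes refl | _ = contradiction e (not-below-leaf w∈S u~w)
    ... | no _ | no _ | yes refl = contradiction e′ (not-below-leaf w∈S u′~w)
    ... | no w≢v | no u≢v | no u′≢v
      rewrite d′-old w≢v | d′-old u≢v | d′-old u′≢v =
      unique-parent (old u∈S u≢v) (old u′∈S u′≢v) (old w∈S w≢v) u~w u′~w e e′

  record Depth : Set where
    field
      depth         : Fin n → ℕ
      adjacent      : ∀ {u v} → u ~ v → depth v ≡ suc (depth u) ⊎ depth u ≡ suc (depth v)
      unique-parent : ∀ {u u′ v} → u ~ v → u′ ~ v →
                      depth v ≡ suc (depth u) → depth v ≡ suc (depth u′) → u ≡ u′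

  acyclic⇒depth : ¬ Cycle G → Depth
  acyclic⇒depth acyclic = record
    { depth = depth ; adjacent = adjacent ∈⊤ ∈⊤ ; unique-parent = unique-parent ∈⊤ ∈⊤ ∈⊤ }
    where open DepthOn (depthOn acyclic ⊤ (<-wellFounded _))

-- Skeletons, matchings and the dichotomy in a rooted forest.

module _ (G : Graph (Fin n)) where
  open GraphProperties G

  Link : (Fin n → Set) → Fin n → Fin n → Set
  Link A x y = A x × A y × ∃ λ s → x ~ s × s ~ y

  -- The vertex sets X(F) of substructures F ∈ 𝒮 of G, described inside G.
  record Skeleton (A : Fin n → Set) : Set where
    field
      inhabited   : ∃ A
      independent : ∀ {x y} → A x → A y → ¬ x ~ y
      other       : ∀ {x s} → A x → x ~ s → ∃ λ y → A y × s ~ y × y ≢ x ×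
                    (∀ {z} → A z → s ~ z → z ≡ x ⊎ z ≡ y)
      connected   : ∀ {x y} → A x → A y → Star (Link A) x y

  -- Next to a neighbour `s` of a vertex of `B` there are two vertices of `B`, and only two of `A`.
  -- So `B` contains every vertex of `A` adjacent to `s`, and it spreads along the links of `A`.
  skeleton-minimal : ∀ {A B} → Skeleton A → Skeleton B → (∀ {v} → B v → A v) →
                     ∀ {v} → A v → B v
  skeleton-minimal {A} {B} skA skB B⊆A av =
    spread (proj₂ B₀) (Skeleton.connected skA (B⊆A (proj₂ B₀)) av)
    where
    B₀ = Skeleton.inhabited skB
    spread : ∀ {x y} → B x → Star (Link A) x y → B y
    spread bx ε = bx
    spread bx ((ax , ay , s , x~s , s~y) ◅ rest)
      with Skeleton.other skB bx x~s | Skeleton.other skA ax x~s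
    ... | y′ , by′ , s~y′ , y′≢x , _ | _ , _ , _ , _ , two with two ay s~y | two (B⊆A by′) s~y′
    ...   | inj₁ refl | _         = spread bx rest
    ...   | inj₂ _    | inj₁ y′≡x = contradiction y′≡x y′≢x
    ...   | inj₂ refl | inj₂ refl = spread by′ rest

  record Matching (A : Fin n → Set) : Set₁ where
    field
      _⋈_        : Fin n → Fin n → Set
      _⋈?_       : ∀ u v → Dec (u ⋈ v)
      ⋈-sym      : ∀ {u v} → u ⋈ v → v ⋈ u
      functional : ∀ {u v w} → u ⋈ v → u ⋈ w → v ≡ w
      ⋈⇒~        : ∀ {u v} → u ⋈ v → u ~ v
      covers     : ∀ {v} → A v → ∃ (v ⋈_)

  module Rooted (D : Depth G) where
    open Depth D

    infix 4 _◁_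

    _◁_ : Fin n → Fin n → Set
    u ◁ v = u ~ v × depth v ≡ suc (depth u)

    _◁?_ : ∀ u v → Dec (u ◁ v)
    u ◁? v = (u ~? v) ×-dec (depth v ℕ.≟ suc (depth u))

    ◁-unique : ∀ {u u′ v} → u ◁ v → u′ ◁ v → u ≡ u′
    ◁-unique (e , d) (e′ , d′) = unique-parent e e′ d d′

    orient : ∀ {u v} → u ~ v → u ◁ v ⊎ v ◁ u
    orient u~v with adjacent u~v
    ... | inj₁ d = inj₁ (u~v , d)
    ... | inj₂ d = inj₂ (~-sym u~v , d)

    ◁⇒< : ∀ {u v} → u ◁ v → depth u < depth v
    ◁⇒< (_ , d) = ≤-reflexive (sym d)

    depth-2 : ∀ {u s v} → u ◁ s → s ◁ v → depth v ≡ 2 + depth u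
    depth-2 (_ , d) (_ , d′) = trans d′ (cong suc d)

    ◁◁⇒< : ∀ {u s v} → u ◁ s → s ◁ v → depth u < depth v
    ◁◁⇒< u◁s s◁v = <-trans (◁⇒< u◁s) (◁⇒< s◁v)

    -- Otherwise `x s y s′` is a 4-cycle. In terms of levels: `x` and `y` have no common child,
    -- parents are unique, and the crossed cases put each of `x` and `y` strictly above the other.
    common-neighbour-unique : ∀ {x y s s′} → x ≢ y → x ~ s → s ~ y → x ~ s′ → s′ ~ y → s ≡ s′
    common-neighbour-unique x≢y x~s s~y x~s′ s′~y
      with orient x~s | orient s~y | orient x~s′ | orient s′~y
    ... | inj₁ x◁s | inj₂ y◁s | _ | _ = contradiction (◁-unique x◁s y◁s) x≢y
    ... | _ | _ | inj₁ x◁s′ | inj₂ y◁s′ = contradiction (◁-unique x◁s′ y◁s′) x≢y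
    ... | inj₂ s◁x | _ | inj₂ s′◁x | _ = ◁-unique s◁x s′◁x
    ... | _ | inj₁ s◁y | _ | inj₁ s′◁y = ◁-unique s◁y s′◁y
    ... | inj₁ x◁s | inj₁ s◁y | inj₂ s′◁x | inj₂ y◁s′ =
      contradiction (◁◁⇒< x◁s s◁y) (ℕ.<-asym (◁◁⇒< y◁s′ s′◁x))
    ... | inj₂ s◁x | inj₂ y◁s | inj₁ x◁s′ | inj₁ s′◁y =
      contradiction (◁◁⇒< y◁s s◁x) (ℕ.<-asym (◁◁⇒< x◁s′ s′◁y))

    module Dichotomy {A : Fin n → Set} (A? : Decidable A) where

      -- Every matching that covers the vertices of A in the subtree rooted at v
      -- contains the edge from v to its parent.
      data Demanding (v : Fin n) : Set where
        demanding : A v → (∀ s → v ◁ s → ∃ λ u → s ◁ u × Demanding u) → Demanding v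

      Blocked : Fin n → Set
      Blocked s = ∃ λ u → s ◁ u × Demanding u

      -- The vertices on no forced edge: a forced edge joins a demanding vertex to its parent, which
      -- is thereby blocked.
      Free : Fin n → Set
      Free v = ¬ Demanding v × ¬ Blocked v

      -- The recursion goes down to grandchildren. Its fuel `k` satisfies `b < depth v + k`, where
      -- `b` bounds all depths, so it never runs out.
      demanding? : Decidable Demanding
      demanding? v = decide (suc b) v (ℕ.m≤n+m (suc b) (depth v))
        where
        b = proj₁ (bounded depth)
        decide : ∀ k v → b < depth v + k → Dec (Demanding v)
        decide zero v b<v = contradiction
          (subst (b <_) (ℕ.+-identityʳ (depth v)) b<v) (ℕ.≤⇒≯ (proj₂ (bounded depth) v))
        decide (suc k) v b<v+1+k = map′
          (λ (av , f) → demanding av f) (λ { (demanding av f) → av , f })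
          (A? v ×-dec all? λ s → Π-dec (v ◁? s) λ v◁s →
            any? λ u → Σ-dec (s ◁? u) λ s◁u → decide k u (deeper v◁s s◁u))
          where
          deeper : ∀ {s u} → v ◁ s → s ◁ u → b < depth u + k
          deeper v◁s s◁u rewrite depth-2 v◁s s◁u =
            m≤n⇒m≤1+n (subst (b <_) (+-suc (depth v) k) b<v+1+k)

      blocked? : Decidable Blocked
      blocked? s = any? λ u → (s ◁? u) ×-dec demanding? u

      free? : Decidable Free
      free? v = ¬? (demanding? v) ×-dec ¬? (blocked? v)

      -- Infinite descent: a demanding `v` makes its demanding child `u` blocked, so `u` is again
      -- both. The two derivations are unfolded alternately.
      demanding⇒¬blocked : ∀ {v} → Demanding v → ¬ Blocked v
      demanding⇒¬blocked (demanding _ f) (u , v◁u , du) = demanding⇒¬blocked du (f u v◁u)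

      heir : Fin n → Fin n
      heir s = choose (λ u → (s ◁? u) ×-dec demanding? u) s

      heir-demanding : ∀ {s} → Blocked s → s ◁ heir s × Demanding (heir s)
      heir-demanding {s} = choose-satisfies (λ u → (s ◁? u) ×-dec demanding? u) s

      -- The two roots coincide when the skeleton hangs from a root of the forest;
      -- otherwise they are siblings and their parent subdivides the edge between them.
      module Grow {r₁ r₂ : Fin n} (dem₁ : Demanding r₁) (dem₂ : Demanding r₂)
                  (top : (r₁ ≡ r₂ × (∀ s → ¬ s ◁ r₁)) ⊎ (r₁ ≢ r₂ × ∃ λ s → s ◁ r₁ × s ◁ r₂)) where

        data Grown : Fin n → Set where
          root₁ : Grown r₁
          root₂ : Grown r₂
          step  : ∀ {u s} → Grown u → u ◁ s → Grown (heir s)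

        grown⇒demanding : ∀ {v} → Grown v → Demanding v
        below-grown     : ∀ {u s} → Grown u → u ◁ s → s ◁ heir s × Demanding (heir s)
        grown⇒demanding root₁        = dem₁
        grown⇒demanding root₂        = dem₂
        grown⇒demanding (step g u◁s) = proj₂ (below-grown g u◁s)
        below-grown g u◁s with grown⇒demanding g
        ... | demanding _ f = heir-demanding (f _ u◁s)

        grown⇒A : ∀ {v} → Grown v → A v
        grown⇒A g with grown⇒demanding g
        ... | demanding av _ = av

        -- Decided upwards: apart from the roots, a derivation for `v` can only come from the
        -- grandparent of `v`, so the depth bounds the recursion.
        grown? : Decidable Grown
        grown? v = decide (depth v) v ≤-refl
          where
          decide : ∀ k v → depth v ≤ k → Dec (Grown v)
          decide k v v≤k with v ≟ r₁ | v ≟ r₂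
          ... | yes refl | _        = yes root₁
          ... | no _     | yes refl = yes root₂
          decide zero v v≤0 | no v≢r₁ | no v≢r₂ = no λ where
            root₁        → v≢r₁ refl
            root₂        → v≢r₂ refl
            (step g u◁s) → ℕ.n≮0 (≤-trans (◁⇒< (proj₁ (below-grown g u◁s))) v≤0)
          decide (suc k) v v≤1+k | no v≢r₁ | no v≢r₂ = map′ to from
            (any? λ s → Σ-dec (s ◁? v) λ s◁v → (v ≟ heir s) ×-dec
              any? λ u → Σ-dec (u ◁? s) λ u◁s →
                decide k u (ℕ.≤-pred (≤-trans (◁◁⇒< u◁s s◁v) v≤1+k)))
            where
            to : (∃ λ s → s ◁ v × v ≡ heir s × ∃ λ u → u ◁ s × Grown u) → Grown v
            to (s , _ , refl , u , u◁s , g) = step g u◁s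
            from : Grown v → ∃ λ s → s ◁ v × v ≡ heir s × ∃ λ u → u ◁ s × Grown u
            from root₁        = contradiction refl v≢r₁
            from root₂        = contradiction refl v≢r₂
            from (step g u◁s) = _ , proj₁ (below-grown g u◁s) , refl , _ , u◁s , g

        depth-r₂ : depth r₂ ≡ depth r₁
        depth-r₂ = [ (λ (r₁≡r₂ , _) → cong depth (sym r₁≡r₂))
                   , (λ (_ , _ , (_ , d₁) , (_ , d₂)) → trans d₂ (sym d₁)) ]′ top

        depth-grown : ∀ {v} → Grown v → depth r₁ ≤ depth v
        depth-grown root₁ = ≤-refl
        depth-grown root₂ = ≤-reflexive (sym depth-r₂)
        depth-grown (step g u◁s) =
          ≤-trans (depth-grown g) (<⇒≤ (◁◁⇒< u◁s (proj₁ (below-grown g u◁s))))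

        -- No grown vertex is higher than the roots, but `u` would be two levels above one. This
        -- prevents a third grown neighbour of `s`, both when `s` is the parent of the roots and
        -- when it is the child of a grown vertex.
        nothing-above : ∀ {u s} → Grown u → u ◁ s → ¬ (s ◁ r₁ ⊎ s ◁ r₂)
        nothing-above g u◁s (inj₁ s◁r) = ℕ.<⇒≱ (◁◁⇒< u◁s s◁r) (depth-grown g)
        nothing-above {u} g u◁s (inj₂ s◁r) =
          ℕ.<⇒≱ (subst (depth u <_) depth-r₂ (◁◁⇒< u◁s s◁r)) (depth-grown g)

        below-two : ∀ {u s z} → Grown u → u ◁ s → Grown z → s ~ z → z ≡ u ⊎ z ≡ heir s
        below-two g u◁s gz s~z with orient s~z
        ... | inj₂ z◁s = inj₁ (◁-unique z◁s u◁s)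
        below-two g u◁s root₁ _ | inj₁ s◁z = contradiction (inj₁ s◁z) (nothing-above g u◁s)
        below-two g u◁s root₂ _ | inj₁ s◁z = contradiction (inj₂ s◁z) (nothing-above g u◁s)
        below-two g u◁s (step g′ u′◁s′) _ | inj₁ s◁z =
          inj₂ (cong heir (◁-unique (proj₁ (below-grown g′ u′◁s′)) s◁z))

        above-two : ∀ {s z} → s ◁ r₁ → Grown z → s ~ z → z ≡ r₁ ⊎ z ≡ r₂
        above-two s◁r gz s~z with orient s~z
        ... | inj₂ z◁s = contradiction (inj₁ s◁r) (nothing-above gz z◁s)
        above-two s◁r root₁ _ | inj₁ _ = inj₁ refl
        above-two s◁r root₂ _ | inj₁ _ = inj₂ refl
        above-two s◁r (step g u◁s) _ | inj₁ s◁z =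
          contradiction (inj₁ s◁r)
            (nothing-above g (subst (_ ◁_) (◁-unique (proj₁ (below-grown g u◁s)) s◁z) u◁s))

        siblings : ∀ {s} → s ◁ r₁ ⊎ s ◁ r₂ → r₁ ≢ r₂ × s ◁ r₁ × s ◁ r₂
        siblings {s} = [ single , pair ]′ top
          where
          Siblings = s ◁ r₁ ⊎ s ◁ r₂ → r₁ ≢ r₂ × s ◁ r₁ × s ◁ r₂
          single : r₁ ≡ r₂ × (∀ s → ¬ s ◁ r₁) → Siblings
          single (r₁≡r₂ , none) (inj₁ s◁r₁) = contradiction s◁r₁ (none s)
          single (r₁≡r₂ , none) (inj₂ s◁r₂) = contradiction (subst (s ◁_) (sym r₁≡r₂) s◁r₂) (none s)
          pair : (r₁ ≢ r₂ × ∃ λ s → s ◁ r₁ × s ◁ r₂) → Siblings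
          pair (r₁≢r₂ , _ , p₁ , p₂) (inj₁ s◁r₁) with refl ← ◁-unique s◁r₁ p₁ = r₁≢r₂ , p₁ , p₂
          pair (r₁≢r₂ , _ , p₁ , p₂) (inj₂ s◁r₂) with refl ← ◁-unique s◁r₂ p₂ = r₁≢r₂ , p₁ , p₂

        other-grown : ∀ {x s} → Grown x → x ~ s → ∃ λ y → Grown y × s ~ y × y ≢ x ×
                      (∀ {z} → Grown z → s ~ z → z ≡ x ⊎ z ≡ y)
        other-grown g x~s with orient x~s
        ... | inj₁ x◁s = _ , step g x◁s , proj₁ s◁h , h≢x , below-two g x◁s
          where
          s◁h = proj₁ (below-grown g x◁s)
          h≢x : heir _ ≢ _
          h≢x eq = <-irrefl (cong depth (sym eq)) (◁◁⇒< x◁s s◁h)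
        other-grown root₁ _ | inj₂ s◁x with siblings (inj₁ s◁x)
        ... | r₁≢r₂ , s◁r₁ , s◁r₂ = _ , root₂ , proj₁ s◁r₂ , r₁≢r₂ ∘ sym , above-two s◁r₁
        other-grown root₂ _ | inj₂ s◁x with siblings (inj₂ s◁x)
        ... | r₁≢r₂ , s◁r₁ , s◁r₂ =
          _ , root₁ , proj₁ s◁r₁ , r₁≢r₂ , λ gz s~z → swap (above-two s◁r₁ gz s~z)
        other-grown (step g u◁s) _ | inj₂ s′◁x
          with refl ← ◁-unique (proj₁ (below-grown g u◁s)) s′◁x =
          _ , g , ~-sym (proj₁ u◁s) , u≢x , λ gz s~z → swap (below-two g u◁s gz s~z)
          where
          u≢x : _ ≢ heir _
          u≢x eq = <-irrefl (cong depth eq) (◁◁⇒< u◁s s′◁x)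

        from-root : ∀ {v} → Grown v → Star (Link Grown) r₁ v
        from-root root₁ = ε
        from-root root₂ =
          [ (λ (r₁≡r₂ , _) → subst (Star (Link Grown) r₁) r₁≡r₂ ε)
          , (λ (_ , s , s◁r₁ , s◁r₂) →
              (root₁ , root₂ , s , ~-sym (proj₁ s◁r₁) , proj₁ s◁r₂) ◅ ε) ]′ top
        from-root (step g u◁s) = from-root g ◅◅
          ((g , step g u◁s , _ , proj₁ u◁s , proj₁ (proj₁ (below-grown g u◁s))) ◅ ε)

        grown-skeleton : Skeleton Grown
        grown-skeleton = record
          { inhabited   = r₁ , root₁
          ; independent = λ gx gy x~y → [ not-above gx gy , not-above gy gx ]′ (orient x~y)
          ; other       = other-grown
          ; connected   = λ gx gy → reverse link-sym (from-root gx) ◅◅ from-root gy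
          }
          where
          not-above : ∀ {x y} → Grown x → Grown y → ¬ x ◁ y
          not-above gx gy x◁y =
            demanding⇒¬blocked (grown⇒demanding gx) (_ , x◁y , grown⇒demanding gy)
          link-sym : ∀ {x y} → Link Grown x y → Link Grown y x
          link-sym (gx , gy , s , x~s , s~y) = gy , gx , s , ~-sym s~y , ~-sym x~s

      -- The parameters exclude the two clashes, so the forced edges form a matching. It remains to
      -- match the free vertices of `A` with other free vertices.
      module Match (has-parent : ∀ {v} → Demanding v → ∃ (_◁ v))
                   (only-child : ∀ {s u u′} → s ◁ u → s ◁ u′ → Demanding u → Demanding u′ → u ≡ u′)
        where

        favourite : Fin n → Fin n
        favourite v = choose (λ u → (v ◁? u) ×-dec free? u) v

        favourite-free : ∀ {v} → (∃ λ u → v ◁ u × Free u) → v ◁ favourite v × Free (favourite v)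
        favourite-free {v} = choose-satisfies (λ u → (v ◁? u) ×-dec free? u) v

        -- The first argument is the depth of v: free vertices are matched greedily
        -- from the roots downwards, each one with its favourite child unless it is
        -- already matched with its parent.
        ChosenAt : ℕ → Fin n → Set
        ChosenAt zero    v = ⊥
        ChosenAt (suc k) v = Free v × ∃ λ p → p ◁ v × Free p × v ≡ favourite p × ¬ ChosenAt k p

        chosenAt? : ∀ k v → Dec (ChosenAt k v)
        chosenAt? zero    v = no λ ()
        chosenAt? (suc k) v = free? v ×-dec any? λ p →
          (p ◁? v) ×-dec free? p ×-dec (v ≟ favourite p) ×-dec ¬? (chosenAt? k p)

        Chosen : Fin n → Set
        Chosen v = ChosenAt (depth v) v

        -- Being chosen depends negatively on the parent, so it cannot be a data type and is
        -- computed by recursion on the depth. This lemma and `chosen⁺` recover the intended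
        -- equivalence without the index.
        chosen⁻ : ∀ {v} → Chosen v →
                  Free v × ∃ λ p → p ◁ v × Free p × v ≡ favourite p × ¬ Chosen p
        chosen⁻ {v} = invert (depth v) refl
          where
          invert : ∀ k → depth v ≡ k → ChosenAt k v →
                   Free v × ∃ λ p → p ◁ v × Free p × v ≡ favourite p × ¬ Chosen p
          invert (suc k) eq (fv , p , p◁v , fp , v≡ , ¬c) =
            fv , p , p◁v , fp , v≡ , subst (λ j → ¬ ChosenAt j p) k≡ ¬c
            where
            k≡ : k ≡ depth p
            k≡ = suc-injective (trans (sym eq) (proj₂ p◁v))

        chosen⁺ : ∀ {p v} → Free v → p ◁ v → Free p → v ≡ favourite p → ¬ Chosen p → Chosen v
        chosen⁺ {p} {v} fv p◁v fp v≡ ¬c =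
          subst (λ k → ChosenAt k v) (sym (proj₂ p◁v)) (fv , p , p◁v , fp , v≡ , ¬c)

        MatchedUp : Fin n → Set
        MatchedUp v = Demanding v ⊎ Chosen v

        matchedUp? : Decidable MatchedUp
        matchedUp? v = demanding? v ⊎-dec chosenAt? (depth v) v

        -- Demanding siblings are excluded by `only-child`, and two chosen siblings are both the
        -- favourite of their parent. The mixed case cannot occur: the parent of a chosen vertex is
        -- free and so has no demanding child.
        siblings-equal : ∀ {s u u′} → s ◁ u → s ◁ u′ → MatchedUp u → MatchedUp u′ → u ≡ u′
        siblings-equal s◁u s◁u′ (inj₁ du) (inj₁ du′) = only-child s◁u s◁u′ du du′
        siblings-equal s◁u s◁u′ (inj₁ du) (inj₂ cu′) with chosen⁻ cu′
        ... | _ , p , p◁u′ , (_ , ¬bp) , _ with refl ← ◁-unique p◁u′ s◁u′ =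
          contradiction (_ , s◁u , du) ¬bp
        siblings-equal s◁u s◁u′ (inj₂ cu) (inj₁ du′) =
          sym (siblings-equal s◁u′ s◁u (inj₁ du′) (inj₂ cu))
        siblings-equal s◁u s◁u′ (inj₂ cu) (inj₂ cu′) with chosen⁻ cu | chosen⁻ cu′
        ... | _ , p , p◁u , _ , u≡ , _ | _ , p′ , p′◁u′ , _ , u′≡ , _
          with refl ← ◁-unique p◁u s◁u | refl ← ◁-unique p′◁u′ s◁u′ = trans u≡ (sym u′≡)

        not-consecutive : ∀ {p v} → p ◁ v → MatchedUp v → ¬ MatchedUp p
        not-consecutive p◁v (inj₁ dv) (inj₁ dp) = demanding⇒¬blocked dp (_ , p◁v , dv)
        not-consecutive p◁v (inj₁ dv) (inj₂ cp) = proj₂ (proj₁ (chosen⁻ cp)) (_ , p◁v , dv)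
        not-consecutive p◁v (inj₂ cv) mp with chosen⁻ cv
        ... | _ , p′ , p′◁v , (¬dp , _) , _ , ¬cp with refl ← ◁-unique p′◁v p◁v =
          [ ¬dp , ¬cp ]′ mp

        matchedUp⇒parent : ∀ {v} → MatchedUp v → ∃ (_◁ v)
        matchedUp⇒parent (inj₁ dv) = has-parent dv
        matchedUp⇒parent (inj₂ cv) with chosen⁻ cv
        ... | _ , p , p◁v , _ = p , p◁v

        -- As `v` is not blocked, none of its children is demanding; if all of them were blocked,
        -- `v` would be demanding.
        free-child : ∀ {v} → A v → Free v → ∃ λ u → v ◁ u × Free u
        free-child {v} av (¬dv , ¬bv) = decidable-stable
          (any? λ u → (v ◁? u) ×-dec free? u)
          (λ none → ¬dv (demanding av λ s v◁s → decidable-stable (blocked? s)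
            λ ¬bs → none (s , v◁s , (λ ds → ¬bv (s , v◁s , ds)) , ¬bs)))

        covered : ∀ {v} → A v → MatchedUp v ⊎ ∃ λ u → v ◁ u × MatchedUp u
        covered {v} av with matchedUp? v | blocked? v
        ... | yes mv | _                   = inj₁ mv
        ... | no _   | yes (u , v◁u , du) = inj₂ (u , v◁u , inj₁ du)
        ... | no ¬mv | no ¬bv =
          inj₂ (favourite v , proj₁ fav ,
            inj₂ (chosen⁺ (proj₂ fav) (proj₁ fav) fv refl (¬mv ∘ inj₂)))
          where
          fv : Free v
          fv = ¬mv ∘ inj₁ , ¬bv
          fav = favourite-free (free-child av fv)

        matching : Matching A
        matching = record
          { _⋈_        = _⋈_
          ; _⋈?_       = λ u v → ((u ◁? v) ×-dec matchedUp? v) ⊎-dec ((v ◁? u) ×-dec matchedUp? u)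
          ; ⋈-sym      = swap
          ; functional = functional
          ; ⋈⇒~        = [ proj₁ ∘ proj₁ , ~-sym ∘ proj₁ ∘ proj₁ ]′
          ; covers     = covers
          }
          where
          _⋈_ : Fin n → Fin n → Set
          u ⋈ v = (u ◁ v × MatchedUp v) ⊎ (v ◁ u × MatchedUp u)
          functional : ∀ {u v w} → u ⋈ v → u ⋈ w → v ≡ w
          functional (inj₁ (u◁v , mv)) (inj₁ (u◁w , mw)) = siblings-equal u◁v u◁w mv mw
          functional (inj₁ (u◁v , mv)) (inj₂ (_ , mu))   = contradiction mu (not-consecutive u◁v mv)
          functional (inj₂ (_ , mu))   (inj₁ (u◁w , mw)) = contradiction mu (not-consecutive u◁w mw)
          functional (inj₂ (v◁u , _))  (inj₂ (w◁u , _))  = ◁-unique v◁u w◁u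
          covers : ∀ {v} → A v → ∃ (v ⋈_)
          covers av with covered av
          ... | inj₁ mv             = _ , inj₂ (proj₂ (matchedUp⇒parent mv) , mv)
          ... | inj₂ (u , v◁u , mu) = u , inj₁ (v◁u , mu)

      matching-or-skeleton : Matching A ⊎
        (Σ[ B ∈ (Fin n → Set) ] Decidable B × Skeleton B × (∀ {v} → B v → A v))
      matching-or-skeleton
        with any? (λ r → demanding? r ×-dec ¬? (any? (_◁? r)))
           | any? (λ u → any? (λ v → ¬? (u ≟ v) ×-dec demanding? u ×-dec demanding? v ×-dec
               any? (λ s → (s ◁? u) ×-dec (s ◁? v))))
      ... | yes (r , dr , none) | _ = inj₂ (Grown , grown? , grown-skeleton , grown⇒A)
        where open Grow dr dr (inj₁ (refl , λ s s◁r → none (s , s◁r)))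
      ... | no _ | yes (u , v , u≢v , du , dv , s) =
        inj₂ (Grown , grown? , grown-skeleton , grown⇒A)
        where open Grow du dv (inj₂ (u≢v , s))
      ... | no ¬root | no ¬pair = inj₁ matching
        where
        open Match
          (λ {v} dv → decidable-stable (any? (_◁? v)) (λ none → ¬root (v , dv , none)))
          (λ {s} {u} {u′} s◁u s◁u′ du du′ → decidable-stable (u ≟ u′)
            (λ u≢u′ → ¬pair (u , u′ , u≢u′ , du , du′ , s , s◁u , s◁u′)))

∈-tabulate⁺ : ∀ {f : Fin n → Bool} {v} → T (f v) → v ∈ tabulate f
∈-tabulate⁺ {f = f} {v} t = lookup⇒[]= v _ (trans (lookup∘tabulate f v) (Equivalence.to T-≡ t))

∈-tabulate⁻ : ∀ {f : Fin n → Bool} {v} → v ∈ tabulate f → T (f v)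
∈-tabulate⁻ {f = f} {v} v∈ = Equivalence.from T-≡ (trans (sym (lookup∘tabulate f v)) ([]=⇒lookup v∈))

Skeleton-resp : ∀ {G : Graph (Fin n)} {A B} → (∀ {v} → A v → B v) → (∀ {v} → B v → A v) →
                Skeleton G B → Skeleton G A
Skeleton-resp {A = A} {B} A⇒B B⇒A sk = record
  { inhabited   = let x , bx = inhabited in x , B⇒A bx
  ; independent = λ ax ay → independent (A⇒B ax) (A⇒B ay)
  ; other       = λ ax x~s → let y , by , s~y , y≢x , two = other (A⇒B ax) x~s in
                  y , B⇒A by , s~y , y≢x , λ az → two (A⇒B az)
  ; connected   = λ ax ay → Star.map (λ (bx , by , path) → B⇒A bx , B⇒A by , path)
                    (connected (A⇒B ax) (A⇒B ay))
  }
  where open Skeleton sk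

-- The game

remaining : Vec (Maybe Player) n → ℕ
remaining []            = 0
remaining (nothing ∷ p) = suc (remaining p)
remaining (just _  ∷ p) = remaining p

remaining-claim : ∀ {P} (p : Vec (Maybe Player) n) v → lookup p v ≡ nothing →
                  remaining (p [ v ]≔ just P) < remaining p
remaining-claim (nothing ∷ p) zero    _ = ≤-refl
remaining-claim (nothing ∷ p) (suc v) e = s≤s (remaining-claim p v e)
remaining-claim (just _  ∷ p) (suc v) e = remaining-claim p v e

∈N[]⁻ : ∀ (G : Graph (Fin n)) {u v} → u ∈ N[ G ] v → T (adj G v u) ⊎ u ≡ v
∈N[]⁻ G u∈ = Sum.map ∈-tabulate⁻ (x∈⁅y⁆⇒x≡y _) (x∈p∪q⁻ _ _ u∈)

∈N[]⁺ : ∀ (G : Graph (Fin n)) {u v} → T (adj G v u) ⊎ u ≡ v → u ∈ N[ G ] v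
∈N[]⁺ G (inj₁ v~u)  = x∈p∪q⁺ (inj₁ (∈-tabulate⁺ v~u))
∈N[]⁺ G (inj₂ refl) = x∈p∪q⁺ (inj₂ (x∈⁅x⁆ _))

module Strategies (G : Graph (Fin n)) (D : Subset n) where
  open GraphProperties G
  open Game G D

  unclaimed? : ∀ p v → Dec (Unclaimed p v)
  unclaimed? p v with lookup p v
  ... | nothing = yes refl
  ... | just _  = no λ ()

  claim-same : ∀ {P} p v → lookup (claim P v p) v ≡ just P
  claim-same p v = lookup∘update v p _

  claim-other : ∀ {P u v} p → u ≢ v → lookup (claim P v p) u ≡ lookup p u
  claim-other p u≢v = lookup∘update′ u≢v p _

  claimed≢unclaimed : ∀ {Q u v} p → lookup p u ≡ just Q → Unclaimed p v → u ≢ v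
  claimed≢unclaimed p e un refl with () ← trans (sym e) un

  claim-keeps : ∀ {P Q u v} p → Unclaimed p v → lookup p u ≡ just Q →
                lookup (claim P v p) u ≡ just Q
  claim-keeps p un e = trans (claim-other p (claimed≢unclaimed p e un)) e

  -- The two strategies are played against each other until they disagree about the final position.
  not-both-win : ∀ {p} → WinsMoving staller p → ¬ WinsWaiting dominator p
  not-both-win′ : ∀ {p} → WinsWaiting staller p → ¬ WinsMoving dominator p
  not-both-win (over _ w)    (over _ ¬w)         = ¬w w
  not-both-win (over o _)    (reply (v , un) _)  = o v un
  not-both-win (move v un _) (over o _)          = o v un
  not-both-win (move v un w) (reply _ f)         = not-both-win′ w (f v un)
  not-both-win′ (over _ w)         (over _ ¬w)    = ¬w w
  not-both-win′ (over o _)         (move v un _)  = o v un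
  not-both-win′ (reply (v , un) _) (over o _)     = o v un
  not-both-win′ (reply _ f)        (move v un w)  = not-both-win (f v un) w

  module Pairing (M : Matching G (_∉ D)) where
    open Matching M

    -- The invariant after each move of Dominator. He may own both vertices of a pair, so when no
    -- pair needs an answer any move will do.
    Guarded : Position → Set
    Guarded p = ∀ {u v} → u ⋈ v → lookup p u ≡ just staller → lookup p v ≡ just dominator

    after-staller : ∀ p {v a b} → Guarded p → Unclaimed p v → a ⋈ b →
                    lookup (claim staller v p) a ≡ just staller →
                    lookup (claim staller v p) b ≡ just dominator ⊎
                    (a ≡ v × Unclaimed (claim staller v p) b)
    after-staller p {v} {a} {b} guarded un a⋈b e with a ≟ v
    ... | no a≢v = inj₁ (claim-keeps p un (guarded a⋈b (trans (sym (claim-other p a≢v)) e)))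
    ... | yes refl with lookup p b in eq
    ...   | nothing        = inj₂ (refl , trans (claim-other p b≢a) eq)
      where
      b≢a : b ≢ a
      b≢a refl = ~-irrefl (⋈⇒~ a⋈b)
    ...   | just dominator = inj₁ (claim-keeps p un eq)
    ...   | just staller   = contradiction refl
              (claimed≢unclaimed p (guarded (⋈-sym a⋈b) eq) un)

    after-reply : ∀ p {v w} → Guarded p → Unclaimed p v →
                  Unclaimed (claim staller v p) w →
                  (∀ {b} → v ⋈ b → Unclaimed (claim staller v p) b → b ≡ w) →
                  Guarded (claim dominator w (claim staller v p))
    after-reply p {v} {w} guarded un un′ only {a} {b} a⋈b e
      with a ≟ w
    ... | yes refl with () ← trans (sym e) (claim-same (claim staller v p) a)
    ... | no a≢w
      with after-staller p guarded un a⋈b (trans (sym (claim-other (claim staller v p) a≢w)) e)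
    ...   | inj₁ dom            = claim-keeps (claim staller v p) un′ dom
    ...   | inj₂ (refl , b-un) with refl ← only a⋈b b-un = claim-same (claim staller v p) b

    guarded-won : ∀ p → Guarded p → ¬ StallerClaimsNbhd p
    guarded-won p guarded (v , v∉D , all) with covers v∉D
    ... | u , v⋈u with () ← trans (sym (guarded v⋈u (all v (∈N[]⁺ G (inj₂ refl)))))
                              (all u (∈N[]⁺ G (inj₁ (⋈⇒~ v⋈u))))

    waiting : ∀ p → Acc _<_ (remaining p) → Guarded p → WinsWaiting dominator p
    waiting p (acc rec) guarded with any? (unclaimed? p)
    ... | no none = over (λ v un → none (v , un)) (guarded-won p guarded)
    ... | yes some = reply some respond
      where
      respond : ∀ v → Unclaimed p v → WinsMoving dominator (claim staller v p)
      respond v un with any? (λ b → (v ⋈? b) ×-dec unclaimed? (claim staller v p) b)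
                      | any? (unclaimed? (claim staller v p))
      ... | yes (w , v⋈w , w-un) | _ = move w w-un (waiting _
              (rec (<-trans (remaining-claim (claim staller v p) w w-un) (remaining-claim p v un)))
              (after-reply p guarded un w-un (λ v⋈b _ → functional v⋈b v⋈w)))
      ... | no none | yes (w , w-un) = move w w-un (waiting _
              (rec (<-trans (remaining-claim (claim staller v p) w w-un) (remaining-claim p v un)))
              (after-reply p guarded un w-un (λ v⋈b b-un → contradiction (_ , v⋈b , b-un) none)))
      -- Staller has claimed the last vertex. If it has a partner, that partner is already
      -- Dominator's, so no reply is missing.
      ... | no _ | no full = over (λ w w-un → full (w , w-un)) (guarded-won (claim staller v p) guarded′)
        where
        guarded′ : Guarded (claim staller v p)
        guarded′ a⋈b e with after-staller p guarded un a⋈b e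
        ... | inj₁ dom        = dom
        ... | inj₂ (_ , b-un) = contradiction (_ , b-un) full

  matching⇒dominatorWins : Matching G (_∉ D) → DominatorWins G D
  matching⇒dominatorWins M = Pairing.waiting M start (<-wellFounded _) initially
    where
    initially : Pairing.Guarded M start
    initially {u} _ e with () ← trans (sym e) (lookup-replicate u nothing)

  claims-persist : ∀ {P v} p → Unclaimed p v → StallerClaimsNbhd p →
                   StallerClaimsNbhd (claim P v p)
  claims-persist p un (x , x∉D , all) = x , x∉D , λ u u∈N → claim-keeps p un (all u u∈N)

  -- The winner is read off only when all vertices are claimed, so a completed neighbourhood has to
  -- be carried through arbitrary further moves.
  already-won  : ∀ p → Acc _<_ (remaining p) → StallerClaimsNbhd p → WinsMoving staller p
  already-won′ : ∀ p → Acc _<_ (remaining p) → StallerClaimsNbhd p → WinsWaiting staller p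
  already-won p (acc rec) won with any? (unclaimed? p)
  ... | no none       = over (λ v un → none (v , un)) won
  ... | yes (v , un)  = move v un
        (already-won′ _ (rec (remaining-claim p v un)) (claims-persist p un won))
  already-won′ p (acc rec) won with any? (unclaimed? p)
  ... | no none  = over (λ v un → none (v , un)) won
  ... | yes some = reply some λ v un →
        already-won _ (rec (remaining-claim p v un)) (claims-persist p un won)

  module Forcing (dep : Depth G) where
    open Depth dep
    open Rooted G dep

    -- Weaker than a skeleton, so that it survives the loss of a vertex: connectedness is dropped,
    -- and a neighbour of `B` left without a second neighbour in `B` is tolerated once Staller owns
    -- it.
    record Threat (p : Position) (B : Fin n → Set) : Set where
      field
        decidable   : Decidable B
        inhabited   : ∃ B
        avoids-D    : ∀ {x} → B x → x ∉ D
        unclaimed   : ∀ {x} → B x → Unclaimed p x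
        independent : ∀ {x y} → B x → B y → ¬ x ~ y
        neighbours  : ∀ {x s} → B x → x ~ s → lookup p s ≡ just staller ⊎
                      (Unclaimed p s × ∃ λ y → B y × s ~ y × y ≢ x)

    take-last : ∀ p {x} → x ∉ D → Unclaimed p x →
                (∀ {s} → x ~ s → lookup p s ≡ just staller) → WinsMoving staller p
    take-last p {x} x∉D un nbrs = move x un (already-won′ _ (<-wellFounded _)
      (x , x∉D , λ u u∈N → claimed u (∈N[]⁻ G u∈N)))
      where
      claimed : ∀ u → T (adj G x u) ⊎ u ≡ x → lookup (claim staller x p) u ≡ just staller
      claimed u (inj₁ x~u)  = claim-keeps p un (nbrs x~u)
      claimed u (inj₂ refl) = claim-same p u

    -- All children of a deepest vertex x of B are already claimed by Staller.  So either
    -- she can complete N[x], or claiming the parent of x forces Dominator to claim x.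
    forced-win : ∀ p → Acc _<_ (remaining p) → ∀ {B} → Threat p B → WinsMoving staller p
    forced-win p (acc rec) {B} threat with argmax decidable depth inhabited
      where open Threat threat
    ... | x , bx , deepest = attack (any? λ s → (x ~? s) ×-dec unclaimed? p s)
      where
      open Threat threat
      x-un = unclaimed bx

      -- An unclaimed child of `x` would have another neighbour in `B`. That one is not its parent,
      -- so it lies two levels below the deepest vertex `x`.
      child-claimed : ∀ {s} → x ◁ s → lookup p s ≡ just staller
      child-claimed x◁s with neighbours bx (proj₁ x◁s)
      ... | inj₁ e = e
      ... | inj₂ (_ , y , by , s~y , y≢x) with orient s~y
      ...   | inj₁ s◁y = contradiction (deepest y by) (ℕ.<⇒≱ (◁◁⇒< x◁s s◁y))
      ...   | inj₂ y◁s = contradiction (◁-unique y◁s x◁s) y≢x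

      unclaimed⇒parent : ∀ {s} → x ~ s → Unclaimed p s → s ◁ x
      unclaimed⇒parent x~s un with orient x~s
      ... | inj₁ x◁s = contradiction refl (claimed≢unclaimed p (child-claimed x◁s) un)
      ... | inj₂ s◁x = s◁x

      attack : Dec (∃ λ s → x ~ s × Unclaimed p s) → WinsMoving staller p
      attack (no none) = take-last p (avoids-D bx) x-un claimed
        where
        claimed : ∀ {s} → x ~ s → lookup p s ≡ just staller
        claimed x~s with neighbours bx x~s
        ... | inj₁ e        = e
        ... | inj₂ (un , _) = contradiction (_ , x~s , un) none
      attack (yes (s , x~s , s-un)) = move s s-un (reply (x , x-un₁) respond)
        where
        s≢ : ∀ {y} → B y → y ≢ s
        s≢ by refl = independent bx by x~s

        p₁ = claim staller s p

        x-un₁ : Unclaimed p₁ x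
        x-un₁ = trans (claim-other p (s≢ bx)) x-un

        x-nbrs : ∀ {t} → x ~ t → lookup p₁ t ≡ just staller
        x-nbrs {t} x~t with neighbours bx x~t
        ... | inj₁ e = claim-keeps p s-un e
        ... | inj₂ (t-un , _)
          with refl ← ◁-unique (unclaimed⇒parent x~t t-un) (unclaimed⇒parent x~s s-un) =
          claim-same p t

        respond : ∀ v → Unclaimed p₁ v → WinsMoving staller (claim dominator v p₁)
        respond v v-un with x ≟ v
        ... | no x≢v = take-last (claim dominator v p₁) (avoids-D bx) (trans (claim-other p₁ x≢v) x-un₁)
                         (λ x~t → claim-keeps p₁ v-un (x-nbrs x~t))
        ... | yes refl = forced-win _
          (rec (<-trans (remaining-claim p₁ x v-un) (remaining-claim p s s-un)))
          {λ y → B y × y ≢ x} (record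
          { decidable   = λ y → decidable y ×-dec ¬? (y ≟ x)
          ; inhabited   = rest
          ; avoids-D    = avoids-D ∘ proj₁
          ; unclaimed   = λ (by , y≢x) →
              trans (claim-other p₁ y≢x) (trans (claim-other p (s≢ by)) (unclaimed by))
          ; independent = λ (by , _) (bz , _) → independent by bz
          ; neighbours  = neighbours′
          })
          where
          rest : ∃ λ y → B y × y ≢ x
          rest with neighbours bx x~s
          ... | inj₁ e = contradiction refl (claimed≢unclaimed p e s-un)
          ... | inj₂ (_ , y , by , _ , y≢x) = y , by , y≢x
          neighbours′ : ∀ {y t} → B y × y ≢ x → y ~ t →
            lookup (claim dominator x p₁) t ≡ just staller ⊎
            (Unclaimed (claim dominator x p₁) t × ∃ λ z → (B z × z ≢ x) × t ~ z × z ≢ y)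
          -- All neighbours of `x` now belong to Staller, and a `t` not adjacent to `x` keeps its
          -- second neighbour in `B` when `x` is removed.
          neighbours′ {y} {t} (by , y≢x) y~t with x ~? t
          ... | yes x~t = inj₁ (claim-keeps p₁ v-un (x-nbrs x~t))
          ... | no x≁t with neighbours by y~t
          ...   | inj₁ e = inj₁ (claim-keeps p₁ v-un (claim-keeps p s-un e))
          ...   | inj₂ (t-un , z , bz , t~z , z≢y) = inj₂
            ( trans (claim-other p₁ t≢x) (trans (claim-other p t≢s) t-un)
            , z , (bz , λ { refl → x≁t (~-sym t~z) }) , t~z , z≢y )
            where
            t≢x : t ≢ x
            t≢x refl = independent by bx y~t
            t≢s : t ≢ s
            t≢s refl = x≁t x~s

  skeleton⇒stallerWins : Depth G → ∀ {B} → Decidable B → Skeleton G B → (∀ {v} → B v → v ∉ D) →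
                         StallerWins G D
  skeleton⇒stallerWins dep {B} B? sk B∉D = Forcing.forced-win dep start (<-wellFounded _) record
    { decidable   = B?
    ; inhabited   = inhabited
    ; avoids-D    = B∉D
    ; unclaimed   = λ {x} _ → lookup-replicate x nothing
    ; independent = independent
    ; neighbours  = λ {x} {s} bx x~s → let y , by , s~y , y≢x , _ = other bx x~s in
                    inj₂ (lookup-replicate s nothing , y , by , s~y , y≢x)
    }
    where open Skeleton sk

-- Criticality in terms of skeletons.

module _ (G : Graph (Fin n)) (acyclic : ¬ Cycle G) (D : Subset n) where

  private
    dep : Depth G
    dep = acyclic⇒depth G acyclic

    matching-or-skeleton : ∀ D → _
    matching-or-skeleton D = Rooted.Dichotomy.matching-or-skeleton G dep (λ v → ¬? (v ∈? D))

  -- A vertex outside both `D` and the skeleton `B` could be added to `D` without disturbing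
  -- Staller's strategy on `B`, against criticality; so `B` is all of the complement of `D`.
  critical⇒skeleton : MBDCritical G D → Skeleton G (_∉ D)
  critical⇒skeleton (wins , loses) with matching-or-skeleton D
  ... | inj₁ M = contradiction
          (Strategies.matching⇒dominatorWins G D M) (Strategies.not-both-win G D wins)
  ... | inj₂ (B , B? , sk , B∉D) = Skeleton-resp ∉D⇒B B∉D sk
    where
    ∉D⇒B : ∀ {v} → v ∉ D → B v
    ∉D⇒B {v} v∉D = decidable-stable (B? v) λ ¬bv →
      Strategies.not-both-win G (D ∪ ⁅ v ⁆)
        (Strategies.skeleton⇒stallerWins G (D ∪ ⁅ v ⁆) dep B? sk (avoids ¬bv))
        (loses v v∉D)
      where
      avoids : ¬ B v → ∀ {u} → B u → u ∉ D ∪ ⁅ v ⁆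
      avoids ¬bv bu u∈ with x∈p∪q⁻ D ⁅ v ⁆ u∈
      ... | inj₁ u∈D = B∉D bu u∈D
      ... | inj₂ u∈v with refl ← x∈⁅y⁆⇒x≡y v u∈v = ¬bv bu

  -- A skeleton avoiding `D` and `v` would be properly contained in the complement of `D`. So for
  -- the enlarged set the dichotomy yields a matching.
  skeleton⇒critical : Skeleton G (_∉ D) → MBDCritical G D
  skeleton⇒critical sk =
    Strategies.skeleton⇒stallerWins G D dep (λ v → ¬? (v ∈? D)) sk (λ v∉D → v∉D) , loses
    where
    loses : ∀ v → v ∉ D → DominatorWins G (D ∪ ⁅ v ⁆)
    loses v v∉D with matching-or-skeleton (D ∪ ⁅ v ⁆)
    ... | inj₁ M = Strategies.matching⇒dominatorWins G (D ∪ ⁅ v ⁆) M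
    ... | inj₂ (B , _ , skB , B∉) = contradiction
      (x∈p∪q⁺ (inj₂ (x∈⁅x⁆ v)))
      (B∉ (skeleton-minimal G sk skB (λ bu u∈D → B∉ bu (x∈p∪q⁺ (inj₁ u∈D))) v∉D))

-- Enumerations, a criterion for acyclicity, and edges as vertices of a subdivision.

T-ext : ∀ {a b} → (T a → T b) → (T b → T a) → a ≡ b
T-ext {false} {false} _ _ = refl
T-ext {false} {true}  _ g = ⊥-elim (g tt)
T-ext {true}  {false} f _ = ⊥-elim (f tt)
T-ext {true}  {true}  _ _ = refl

∨-dec⁻ : ∀ {P Q : Set} (P? : Dec P) (Q? : Dec Q) → T (⌊ P? ⌋ ∨ ⌊ Q? ⌋) → P ⊎ Q
∨-dec⁻ (yes p) _       _ = inj₁ p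
∨-dec⁻ (no _)  (yes q) _ = inj₂ q

∨-dec⁺ : ∀ {P Q : Set} (P? : Dec P) (Q? : Dec Q) → P ⊎ Q → T (⌊ P? ⌋ ∨ ⌊ Q? ⌋)
∨-dec⁺ (yes _) _       _        = tt
∨-dec⁺ (no _)  (yes _) _        = tt
∨-dec⁺ (no ¬p) (no _)  (inj₁ p) = contradiction p ¬p
∨-dec⁺ (no _)  (no ¬q) (inj₂ q) = contradiction q ¬q

-- `In𝒮` asks for a tree on some `Fin m`, so the vertices of a skeleton have to be renumbered.
record Enumeration (A : Fin n → Set) : Set where
  field
    {size}    : ℕ
    enum      : Fin size → Fin n
    injective : ∀ {i j} → enum i ≡ enum j → i ≡ j
    sound     : ∀ i → A (enum i)
    complete  : ∀ {v} → A v → ∃ λ i → enum i ≡ v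

enumerate : {A : Fin n → Set} → Decidable A → Enumeration A
enumerate {n = zero} A? = record
  { size = 0 ; enum = λ () ; injective = λ {} ; sound = λ () ; complete = λ {} }
enumerate {n = suc n} {A} A? with enumerate (A? ∘ suc) | A? zero
... | rest | no ¬A0 = record
  { enum      = suc ∘ enum
  ; injective = injective ∘ Fin.suc-injective
  ; sound     = sound
  ; complete  = complete′
  }
  where
  open Enumeration rest
  complete′ : ∀ {v} → A v → ∃ λ i → suc (enum i) ≡ v
  complete′ {zero}  av = contradiction av ¬A0
  complete′ {suc v} av = let i , eq = complete av in i , cong suc eq
... | rest | yes A0 = record
  { enum = enum′ ; injective = injective′ ; sound = sound′ ; complete = complete′ }
  where
  open Enumeration rest
  enum′ : Fin (suc size) → Fin (suc n)
  enum′ zero    = zero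
  enum′ (suc i) = suc (enum i)
  injective′ : ∀ {i j} → enum′ i ≡ enum′ j → i ≡ j
  injective′ {zero}  {zero}  _  = refl
  injective′ {suc i} {suc j} eq = cong suc (injective (Fin.suc-injective eq))
  sound′ : ∀ i → A (enum′ i)
  sound′ zero    = A0
  sound′ (suc i) = sound i
  complete′ : ∀ {v} → A v → ∃ λ i → enum′ i ≡ v
  complete′ {zero}  _  = zero , refl
  complete′ {suc v} av = let i , eq = complete av in suc i , cong suc eq

cycle-neighbours : ∀ {V} {G : Graph V} (C : Cycle G) → let open Cycle C in ∀ i →
  ∃₂ λ j k → T (adj G (c i) (c j)) × T (adj G (c i) (c k)) × c j ≢ c k
cycle-neighbours {G = G} C zero = suc zero , fromℕ _ , step zero , ~-sym close , λ eq →
  case injective eq of λ ()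
  where
  open Cycle C
  open GraphProperties G
cycle-neighbours {G = G} C (suc i) = next (view (suc i)) refl
  where
  open Cycle C
  open GraphProperties G
  next : ∀ {t} → View t → t ≡ suc i → ∃₂ λ j k → c (suc i) ~ c j × c (suc i) ~ c k × c j ≢ c k
  next ‵fromℕ refl =
    inject₁ i , zero , ~-sym (step i) , close , λ eq → case injective eq of λ ()
  next (‵inject₁ t) eq =
    inject₁ i , suc t , ~-sym (step i) , subst (λ u → c u ~ c (suc t)) eq (step t) , λ same →
    <-irrefl (cong toℕ (injective same)) i<t
    where
    i<t : toℕ (inject₁ i) < toℕ (suc t)
    i<t rewrite toℕ-inject₁ i = ≤-trans (≤-reflexive (trans (sym (cong toℕ eq)) (toℕ-inject₁ t)))
            (n≤1+n (toℕ t))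

-- A deepest vertex of a cycle has two neighbours that are not deeper. The inequalities are weak
-- because the tree built from a skeleton may join two vertices of equal depth, namely siblings.
acyclic-by-depth : ∀ {V} (G : Graph V) (d : V → ℕ) →
  (∀ {v u u′} → T (adj G v u) → T (adj G v u′) → d u ≤ d v → d u′ ≤ d v → u ≡ u′) → ¬ Cycle G
acyclic-by-depth G d one-above C with argmax (λ _ → yes tt) (d ∘ Cycle.c C) (zero , tt)
... | i , _ , max with cycle-neighbours C i
...   | j , k , i~j , i~k , j≢k = j≢k (one-above i~j i~k (max j tt) (max k tt))

isEndpoint⁻ : ∀ {m} {G : Graph (Fin m)} {v} (e : Edge G) → T (isEndpoint {G = G} v e) →
              v ≡ proj₁ (proj₁ e) ⊎ v ≡ proj₂ (proj₁ e)
isEndpoint⁻ ((i , j) , _) = ∨-dec⁻ (_ ≟ i) (_ ≟ j)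

isEndpoint⁺ : ∀ {m} {G : Graph (Fin m)} {v} (e : Edge G) →
              v ≡ proj₁ (proj₁ e) ⊎ v ≡ proj₂ (proj₁ e) → T (isEndpoint {G = G} v e)
isEndpoint⁺ ((i , j) , _) = ∨-dec⁺ (_ ≟ i) (_ ≟ j)

edge-≡ : ∀ {m} {G : Graph (Fin m)} {e e′ : Edge G} → proj₁ e ≡ proj₁ e′ → e ≡ e′
edge-≡ {e = _ , p , t} {_ , p′ , t′} refl =
  cong (_ ,_) (cong₂ _,_ (Fin.<-irrelevant p p′) (T-irrelevant t t′))

∃∈-≡ : ∀ {S : Subset n} {x y : ∃ (_∈ S)} → proj₁ x ≡ proj₁ y → x ≡ y
∃∈-≡ {x = _ , p} {_ , q} refl = cong (_ ,_) ([]=-irrelevant p q)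

full-↔ : ∀ {S : Subset n} → (∀ v → v ∈ S) → ∃ (_∈ S) ↔ Fin n
full-↔ all = mk↔ₛ′ proj₁ (λ v → v , all v) (λ _ → refl) (λ _ → ∃∈-≡ refl)

-- From skeletons to substructures

module FromSkeleton (G : Graph (Fin n)) (dep : Depth G)
                    {A : Fin n → Set} (A? : Decidable A) (sk : Skeleton G A) where
  open GraphProperties G
  open Depth dep
  open Rooted G dep
  open Skeleton sk
  open Enumeration (enumerate A?)

  Linked : Fin size → Fin size → Set
  Linked i j = i ≢ j × ∃ λ s → enum i ~ s × s ~ enum j

  linked? : ∀ i j → Dec (Linked i j)
  linked? i j = ¬? (i ≟ j) ×-dec any? λ s → (enum i ~? s) ×-dec (s ~? enum j)

  linked-sym : ∀ {i j} → Linked i j → Linked j i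
  linked-sym (i≢j , s , i~s , s~j) = i≢j ∘ sym , s , ~-sym s~j , ~-sym i~s

  -- The tree is recovered by suppressing the subdividing vertices: two vertices of `A` are joined
  -- when they have a common neighbour.
  T′ : Graph (Fin size)
  T′ = record
    { adj        = λ i j → ⌊ linked? i j ⌋
    ; adj-sym    = λ i j → T-ext (λ t → fromWitness (linked-sym (toWitness t)))
                                 (λ t → fromWitness (linked-sym (toWitness t)))
    ; adj-irrefl = λ i → T-ext (λ t → proj₁ (toWitness t) refl) (λ ())
    }

  enum-≢ : ∀ {i j} → i ≢ j → enum i ≢ enum j
  enum-≢ i≢j eq = i≢j (injective eq)

  two-enum : ∀ {i j k s} → enum i ~ s → s ~ enum j → s ~ enum k → j ≢ i → k ≡ i ⊎ k ≡ j
  two-enum {i} {j} {k} i~s s~j s~k j≢i with other (sound i) i~s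
  ... | _ , _ , _ , _ , two with two (sound j) s~j | two (sound k) s~k
  ...   | inj₁ j≡i | _        = contradiction j≡i (enum-≢ j≢i)
  ...   | inj₂ _   | inj₁ k≡i = inj₁ (injective k≡i)
  ...   | inj₂ j≡y | inj₂ k≡y = inj₂ (injective (trans k≡y (sym j≡y)))

  T′-connected : ∀ i j → Star (Graph._~_ T′) i j
  T′-connected i j = convert i j refl refl (connected (sound i) (sound j))
    where
    convert : ∀ {x y} i j → enum i ≡ x → enum j ≡ y → Star (Link G A) x y → Star (Graph._~_ T′) i j
    convert i j refl eq ε with refl ← injective eq = ε
    convert i j refl eq ((_ , az , s , x~s , s~z) ◅ rest) with complete az
    ... | k , refl with i ≟ k
    ...   | yes refl = convert i j refl eq rest
    ...   | no i≢k   = fromWitness (i≢k , s , x~s , s~z) ◅ convert k j refl eq rest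

  T′-acyclic : ¬ Cycle T′
  T′-acyclic = acyclic-by-depth T′ (depth ∘ enum) one-above
    where
    -- A neighbour of `i` in `T′` that is not deeper is reached through the parent of `enum i`, and
    -- next to that parent lies only one further vertex of `A`.
    through-parent : ∀ {i j s} → i ≢ j → enum i ~ s → s ~ enum j →
                     depth (enum j) ≤ depth (enum i) → s ◁ enum i
    through-parent i≢j i~s s~j j≤i with orient i~s | orient s~j
    ... | inj₂ s◁i | _        = s◁i
    ... | inj₁ i◁s | inj₁ s◁j = contradiction j≤i (ℕ.<⇒≱ (◁◁⇒< i◁s s◁j))
    ... | inj₁ i◁s | inj₂ j◁s = contradiction (◁-unique i◁s j◁s) (enum-≢ i≢j)
    one-above : ∀ {i j k} → T (adj T′ i j) → T (adj T′ i k) → depth (enum j) ≤ depth (enum i) →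
                depth (enum k) ≤ depth (enum i) → j ≡ k
    one-above i~j i~k j≤i k≤i with toWitness i~j | toWitness i~k
    ... | i≢j , s , i~s , s~j | i≢k , s′ , i~s′ , s′~k
      with refl ← ◁-unique (through-parent i≢j i~s s~j j≤i) (through-parent i≢k i~s′ s′~k k≤i)
      with two-enum i~s s~j s′~k (i≢j ∘ sym)
    ...   | inj₁ k≡i = contradiction (sym k≡i) i≢k
    ...   | inj₂ k≡j = sym k≡j

  T′-isTree : IsTree T′
  T′-isTree = record
    { nonempty  = proj₁ (complete (proj₂ inhabited))
    ; connected = T′-connected
    ; acyclic   = T′-acyclic
    }

  InF : Fin n → Set
  InF v = A v ⊎ ∃ λ x → A x × x ~ v

  inF? : Decidable InF
  inF? v = A? v ⊎-dec any? λ x → A? x ×-dec (x ~? v)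

  -- Requiring an end in `A` keeps the full degree at `A` and makes the subdividing vertices
  -- pairwise nonadjacent by definition.
  edges : Graph (Fin n)
  edges = record
    { adj        = λ u v → adj G u v ∧ (⌊ A? u ⌋ ∨ ⌊ A? v ⌋)
    ; adj-sym    = λ u v → cong₂ _∧_ (Graph.adj-sym G u v) (∨-comm ⌊ A? u ⌋ ⌊ A? v ⌋)
    ; adj-irrefl = λ v → cong (_∧ (⌊ A? v ⌋ ∨ ⌊ A? v ⌋)) (Graph.adj-irrefl G v)
    }

  edges⁻ : ∀ {u v} → T (adj edges u v) → u ~ v × (A u ⊎ A v)
  edges⁻ {u} {v} t = let u~v , a = Equivalence.to T-∧ t in u~v , ∨-dec⁻ (A? u) (A? v) a

  edges⁺ : ∀ {u v} → u ~ v → A u ⊎ A v → T (adj edges u v)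
  edges⁺ {u} {v} u~v a = Equivalence.from T-∧ (u~v , ∨-dec⁺ (A? u) (A? v) a)

  F : Subgraph G
  F = record
    { verts    = tabulate (λ v → ⌊ inF? v ⌋)
    ; edges    = edges
    ; edges⊆G  = λ u v → proj₁ ∘ edges⁻
    ; endpoint = λ u v → ∈-tabulate⁺ ∘ fromWitness ∘ inF
    }
    where
    inF : ∀ {u v} → T (adj edges u v) → InF u
    inF t with edges⁻ t
    ... | _   , inj₁ au = inj₁ au
    ... | u~v , inj₂ av = inj₂ (_ , av , ~-sym u~v)

  open Subgraph F using (Vertex; toGraph; verts)

  middle : Edge T′ → Fin n
  middle (_ , _ , t) = proj₁ (proj₂ (toWitness t))

  middle-left : ∀ e → enum (proj₁ (proj₁ e)) ~ middle e
  middle-left (_ , _ , t) = proj₁ (proj₂ (proj₂ (toWitness t)))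

  middle-right : ∀ e → middle e ~ enum (proj₂ (proj₁ e))
  middle-right (_ , _ , t) = proj₂ (proj₂ (proj₂ (toWitness t)))

  endpoints-≢ : (e : Edge T′) → proj₂ (proj₁ e) ≢ proj₁ (proj₁ e)
  endpoints-≢ (_ , i<j , _) eq = Fin.<-irrefl (sym eq) i<j

  middle-endpoint : ∀ e {k} → middle e ~ enum k → k ≡ proj₁ (proj₁ e) ⊎ k ≡ proj₂ (proj₁ e)
  middle-endpoint e s~k = two-enum (middle-left e) (middle-right e) s~k (endpoints-≢ e)

  middle∉A : ∀ e → ¬ A (middle e)
  middle∉A e am = independent (sound _) am (middle-left e)

  π : Fin size ⊎ Edge T′ → Fin n
  π (inj₁ i) = enum i
  π (inj₂ e) = middle e

  embed : Fin size ⊎ Edge T′ → Vertex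
  embed x = π x , ∈-tabulate⁺ (fromWitness (inF x))
    where
    inF : ∀ x → InF (π x)
    inF (inj₁ i) = inj₁ (sound i)
    inF (inj₂ e) = inj₂ (_ , sound _ , middle-left e)

  π-injective : ∀ {x y} → π x ≡ π y → x ≡ y
  π-injective {inj₁ i} {inj₁ j} eq = cong inj₁ (injective eq)
  π-injective {inj₁ i} {inj₂ e} eq = contradiction (subst A eq (sound i)) (middle∉A e)
  π-injective {inj₂ e} {inj₁ i} eq = contradiction (subst A (sym eq) (sound i)) (middle∉A e)
  -- Equal middle vertices have the same two neighbours in `A`, so the edges have the same ends;
  -- `i<j` and `k<l` exclude that these are swapped.
  π-injective {inj₂ e@((i , j) , i<j , _)} {inj₂ e′@((k , l) , k<l , _)} eq = cong inj₂ (edge-≡ {G = T′} same)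
    where
    same : (i , j) ≡ (k , l)
    same with middle-endpoint e (subst (_~ enum k) (sym eq) (~-sym (middle-left e′)))
            | middle-endpoint e (subst (_~ enum l) (sym eq) (middle-right e′))
    ... | inj₁ refl | inj₂ refl = refl
    ... | inj₁ refl | inj₁ refl = contradiction k<l (Fin.<-irrefl refl)
    ... | inj₂ refl | inj₂ refl = contradiction k<l (Fin.<-irrefl refl)
    ... | inj₂ refl | inj₁ refl = contradiction k<l (Fin.<-asym i<j)

  -- A vertex `v` outside `A` lies between two vertices of `A`. `middle` selects its own common
  -- neighbour of the two, and uniqueness of common neighbours identifies it with `v`.
  π-surjective : ∀ {v} → InF v → ∃ λ x → π x ≡ v
  π-surjective {v} v∈F with A? v
  ... | yes av = let i , eq = complete av in inj₁ i , eq
  π-surjective {v} (inj₁ av) | no ¬av = contradiction av ¬av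
  π-surjective {v} (inj₂ (x , ax , x~v)) | no _ with other ax x~v
  ... | y , ay , v~y , y≢x , _ with complete ax | complete ay
  ...   | i , refl | j , refl with Fin.<-cmp i j
  ...     | tri< i<j i≢j _ = inj₂ e ,
              common-neighbour-unique (y≢x ∘ sym) (middle-left e) (middle-right e) x~v v~y
    where
    e : Edge T′
    e = (i , j) , i<j , fromWitness (i≢j , v , x~v , v~y)
  ...     | tri≈ _ i≡j _ = contradiction (cong enum (sym i≡j)) y≢x
  ...     | tri> _ i≢j j<i = inj₂ e ,
              common-neighbour-unique y≢x (middle-left e) (middle-right e) (~-sym v~y) (~-sym x~v)
    where
    e : Edge T′
    e = (j , i) , j<i , fromWitness (i≢j ∘ sym , v , ~-sym v~y , ~-sym x~v)

  enum-middle : ∀ i e → adj edges (enum i) (middle e) ≡ isEndpoint {G = T′} i e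
  enum-middle i e = T-ext
    (λ t → isEndpoint⁺ {G = T′} e (middle-endpoint e (~-sym (proj₁ (edges⁻ t)))))
    (λ t → edges⁺ (meets (isEndpoint⁻ {G = T′} e t)) (inj₁ (sound i)))
    where
    meets : i ≡ proj₁ (proj₁ e) ⊎ i ≡ proj₂ (proj₁ e) → enum i ~ middle e
    meets (inj₁ refl) = middle-left e
    meets (inj₂ refl) = ~-sym (middle-right e)

  embed-adj : ∀ x y → adj edges (π x) (π y) ≡ adj (subdivide T′) x y
  embed-adj (inj₁ i) (inj₁ j) = T-ext
    (λ t → independent (sound i) (sound j) (proj₁ (edges⁻ t))) (λ ())
  embed-adj (inj₁ i) (inj₂ e) = enum-middle i e
  embed-adj (inj₂ e) (inj₁ i) = trans (Graph.adj-sym edges (middle e) (enum i)) (enum-middle i e)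
  embed-adj (inj₂ e) (inj₂ e′) = T-ext
    (λ t → [ middle∉A e , middle∉A e′ ]′ (proj₂ (edges⁻ t))) (λ ())

  F∈𝒮 : In𝒮 toGraph
  F∈𝒮 = record
    { T′   = T′
    ; tree = T′-isTree
    ; iso  = record
      { bijection    = ⤖⇒↔ (mk⤖ ((λ eq → π-injective (cong proj₁ eq)) , surjective))
      ; preserve-adj = embed-adj
      }
    }
    where
    surjective : ∀ y → ∃ λ x → ∀ {z} → z ≡ x → embed z ≡ y
    surjective (v , v∈F) with π-surjective (toWitness (∈-tabulate⁻ v∈F))
    ... | x , eq = x , λ { refl → ∃∈-≡ eq }

  X⇒A : ∀ {v} → XIn F F∈𝒮 v → A v
  X⇒A (_ , i , eq) = subst A (cong proj₁ eq) (sound i)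

  A⇒X : ∀ {v} → A v → XIn F F∈𝒮 v
  A⇒X av with complete av
  ... | i , refl = _ , i , refl

  substructure : IsSubstructure G F F∈𝒮
  substructure v v∈X = cong ∣_∣ (tabulate-cong λ u →
    T-ext (λ v~u → edges⁺ {v} {u} v~u (inj₁ (X⇒A v∈X))) (proj₁ ∘ edges⁻ {v} {u}))

-- From substructures to skeletons

full-degree⇒same-neighbours : ∀ (G H : Graph (Fin n)) {v} →
  (∀ {u} → T (adj H v u) → T (adj G v u)) → deg G v ≡ deg H v →
  ∀ {u} → T (adj G v u) → T (adj H v u)
full-degree⇒same-neighbours G H {v} H⊆G same {u} v~u =
  decidable-stable (T? (adj H v u)) λ v≁u → <-irrefl (sym same)
    (p⊂q⇒∣p∣<∣q∣ ( (λ w∈ → ∈-tabulate⁺ (H⊆G (∈-tabulate⁻ w∈)))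
                 , u , ∈-tabulate⁺ v~u , v≁u ∘ ∈-tabulate⁻))

module FromSubstructure (G : Graph (Fin n)) (F : Subgraph G)
                        (F∈𝒮 : In𝒮 (Subgraph.toGraph F)) (sub : IsSubstructure G F F∈𝒮) where
  open GraphProperties G
  open Subgraph F
  open In𝒮 F∈𝒮
  open _≅_ iso

  XF : Fin n → Set
  XF = XIn F F∈𝒮

  π : Fin m ⊎ Edge T′ → Fin n
  π x = proj₁ (to x)

  π-injective : ∀ {x y} → π x ≡ π y → x ≡ y
  π-injective eq = Injection.injective (↔⇒↣ bijection) (∃∈-≡ eq)

  π-surjective : ∀ {v} → v ∈ verts → ∃ λ x → π x ≡ v
  π-surjective v∈F = from (_ , v∈F) , cong proj₁ (Inverse.strictlyInverseˡ bijection (_ , v∈F))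

  X-π : ∀ i → XF (π (inj₁ i))
  X-π i = proj₂ (to (inj₁ i)) , i , refl

  X? : Decidable XF
  X? v = map′ (λ { (i , refl) → X-π i }) (λ (_ , i , eq) → i , cong proj₁ eq)
    (any? λ i → π (inj₁ i) ≟ v)

  edge⇒adj : ∀ {x y} → T (adj edges (π x) (π y)) → T (adj (subdivide T′) x y)
  edge⇒adj {x} {y} = subst T (preserve-adj x y)

  adj⇒~ : ∀ {x y} → T (adj (subdivide T′) x y) → π x ~ π y
  adj⇒~ {x} {y} t = edges⊆G _ _ (subst T (sym (preserve-adj x y)) t)

  -- The degree condition enters here: at a vertex of `X(F)` every edge of `G` belongs to `F`.
  X-edge : ∀ {v u} → XF v → v ~ u → T (adj edges v u)
  X-edge {v} v∈X = full-degree⇒same-neighbours G edges (edges⊆G _ _) (sub v v∈X)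

  X-neighbour∈F : ∀ {v u} → XF v → v ~ u → u ∈ verts
  X-neighbour∈F {v} {u} v∈X v~u =
    endpoint u v (subst T (Graph.adj-sym edges v u) (X-edge v∈X v~u))

  ~⇒endpoint : ∀ {i e} → π (inj₁ i) ~ π (inj₂ e) → T (isEndpoint {G = T′} i e)
  ~⇒endpoint {i} {e} i~e = edge⇒adj {inj₁ i} {inj₂ e} (X-edge (X-π i) i~e)

  neighbour-is-edge : ∀ {i s} → π (inj₁ i) ~ s → ∃ λ e → π (inj₂ e) ≡ s
  neighbour-is-edge {i} i~s with π-surjective (X-neighbour∈F (X-π i) i~s)
  ... | inj₁ j , refl = ⊥-elim (edge⇒adj {inj₁ i} {inj₁ j} (X-edge (X-π i) i~s))
  ... | inj₂ e , eq   = e , eq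

  skeleton : Skeleton G XF
  skeleton = record
    { inhabited   = _ , X-π (IsTree.nonempty tree)
    ; independent = λ { (_ , i , refl) (_ , j , refl) i~j →
                        edge⇒adj {inj₁ i} {inj₁ j} (X-edge (X-π i) i~j) }
    ; other       = λ { (_ , i , refl) i~s → other i i~s }
    ; connected   = λ { (_ , i , refl) (_ , j , refl) →
                        gmap (π ∘ inj₁) link (IsTree.connected tree i j) }
    }
    where
    Other : Fin n → Fin n → Set
    Other x s = ∃ λ y → XF y × s ~ y × y ≢ x × (∀ {z} → XF z → s ~ z → z ≡ x ⊎ z ≡ y)
    two : ∀ e {z} → XF z → π (inj₂ e) ~ z →
          z ≡ π (inj₁ (proj₁ (proj₁ e))) ⊎ z ≡ π (inj₁ (proj₂ (proj₁ e)))
    two e (_ , l , refl) e~z = Sum.map (cong (π ∘ inj₁)) (cong (π ∘ inj₁))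
      (isEndpoint⁻ {G = T′} {l} e (~⇒endpoint {l} {e} (~-sym e~z)))
    other : ∀ i {s} → π (inj₁ i) ~ s → Other (π (inj₁ i)) s
    other i i~s with neighbour-is-edge {i} i~s
    ... | e@((j , k) , j<k , _) , refl with isEndpoint⁻ {G = T′} {i} e (~⇒endpoint {i} {e} i~s)
    ...   | inj₁ refl = _ , X-π k ,
              adj⇒~ {inj₂ e} {inj₁ k} (isEndpoint⁺ {G = T′} e (inj₂ refl)) ,
              (λ eq → case π-injective eq of λ { refl → Fin.<-irrefl refl j<k }) , two e
    ...   | inj₂ refl = _ , X-π j ,
              adj⇒~ {inj₂ e} {inj₁ j} (isEndpoint⁺ {G = T′} e (inj₁ refl)) ,
              (λ eq → case π-injective eq of λ { refl → Fin.<-irrefl refl j<k }) ,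
              λ z∈X e~z → swap (two e z∈X e~z)
    via : ∀ {i j} (e : Edge T′) → T (isEndpoint {G = T′} i e) → T (isEndpoint {G = T′} j e) →
          Link G XF (π (inj₁ i)) (π (inj₁ j))
    via {i} {j} e ie je = X-π i , X-π j , π (inj₂ e) ,
      adj⇒~ {inj₁ i} {inj₂ e} ie , adj⇒~ {inj₂ e} {inj₁ j} je
    link : ∀ {i j} → T (adj T′ i j) → Link G XF (π (inj₁ i)) (π (inj₁ j))
    link {i} {j} i~j with Fin.<-cmp i j
    ... | tri< i<j _ _ = via e (isEndpoint⁺ {G = T′} e (inj₁ refl)) (isEndpoint⁺ {G = T′} e (inj₂ refl))
      where
      e : Edge T′
      e = (i , j) , i<j , i~j
    ... | tri≈ _ refl _ = contradiction i~j (GraphProperties.~-irrefl T′)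
    ... | tri> _ _ j<i = via e (isEndpoint⁺ {G = T′} e (inj₂ refl)) (isEndpoint⁺ {G = T′} e (inj₁ refl))
      where
      e : Edge T′
      e = (j , i) , j<i , GraphProperties.~-sym T′ i~j

-- Spanning substructures and the two equivalences.

module _ (G : Graph (Fin n)) where
  open GraphProperties G

  whole : Subgraph G
  whole = record { verts = ⊤ ; edges = G ; edges⊆G = λ _ _ e → e ; endpoint = λ _ _ _ → ∈⊤ }

  In𝒮⇒whole : In𝒮 G → In𝒮 (Subgraph.toGraph whole)
  In𝒮⇒whole G∈𝒮 = record
    { T′ = T′ ; tree = tree
    ; iso = record
      { bijection    = ↔-sym (full-↔ λ _ → ∈⊤) ↔-∘ bijection
      ; preserve-adj = preserve-adj
      }
    }
    where
    open In𝒮 G∈𝒮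
    open _≅_ iso

  spanning⇒In𝒮 : (F : Subgraph G) → (∀ v → v ∈ Subgraph.verts F) →
    (∀ {u v} → u ~ v → T (adj (Subgraph.edges F) u v)) → In𝒮 (Subgraph.toGraph F) → In𝒮 G
  spanning⇒In𝒮 F all-verts all-edges F∈𝒮 = record
    { T′ = T′ ; tree = tree
    ; iso = record
      { bijection    = full-↔ all-verts ↔-∘ bijection
      ; preserve-adj = λ x y → trans (T-ext all-edges (Subgraph.edges⊆G F _ _)) (preserve-adj x y)
      }
    }
    where
    open In𝒮 F∈𝒮
    open _≅_ iso

  module _ (G∈𝒮 : In𝒮 G) where
    open In𝒮 G∈𝒮
    open _≅_ iso

    outside-X : ∀ {v} → ¬ X G∈𝒮 v → ∃ λ e → to (inj₂ e) ≡ v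
    outside-X {v} v∉X with from v | Inverse.strictlyInverseˡ bijection v
    ... | inj₁ i | eq = contradiction (i , eq) v∉X
    ... | inj₂ e | eq = e , eq

    outside-X-independent : ∀ {u v} → ¬ X G∈𝒮 u → ¬ X G∈𝒮 v → ¬ u ~ v
    outside-X-independent u∉X v∉X u~v with outside-X u∉X | outside-X v∉X
    ... | e , refl | e′ , refl = subst T (preserve-adj (inj₂ e) (inj₂ e′)) u~v

    outside-X-not-isolated : ∀ {v} → ¬ X G∈𝒮 v → ¬ Isolated G v
    outside-X-not-isolated v∉X isolated with outside-X v∉X
    ... | e@((i , _) , _) , refl = isolated (to (inj₁ i))
      (subst T (sym (preserve-adj (inj₂ e) (inj₁ i))) (isEndpoint⁺ {G = T′} e (inj₁ refl)))

substructure⇔critical : (G : Graph (Fin n)) → ¬ Cycle G → (D : Subset n) →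
  MBDCritical G D ⇔
    (Σ[ F ∈ Subgraph G ] Σ[ F∈𝒮 ∈ In𝒮 (Subgraph.toGraph F) ]
      (IsSubstructure G F F∈𝒮 × D ≐V∖ XIn F F∈𝒮))
substructure⇔critical G acyclic D = mk⇔ to from
  where
  to : MBDCritical G D → Σ[ F ∈ Subgraph G ] Σ[ F∈𝒮 ∈ In𝒮 (Subgraph.toGraph F) ]
         (IsSubstructure G F F∈𝒮 × D ≐V∖ XIn F F∈𝒮)
  to crit = F , F∈𝒮 , substructure , λ v → mk⇔
    (λ v∈D v∈X → X⇒A v∈X v∈D) (λ v∉X → decidable-stable (v ∈? D) (v∉X ∘ A⇒X))
    where
    open FromSkeleton G (acyclic⇒depth G acyclic) (λ v → ¬? (v ∈? D))
           (critical⇒skeleton G acyclic D crit)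
  from : Σ[ F ∈ Subgraph G ] Σ[ F∈𝒮 ∈ In𝒮 (Subgraph.toGraph F) ]
           (IsSubstructure G F F∈𝒮 × D ≐V∖ XIn F F∈𝒮) → MBDCritical G D
  from (F , F∈𝒮 , sub , D≐) = skeleton⇒critical G acyclic D (Skeleton-resp
    (λ {v} v∉D → decidable-stable (X? v) (v∉D ∘ Equivalence.from (D≐ v)))
    (λ {v} v∈X v∈D → Equivalence.to (D≐ v) v∈D v∈X)
    skeleton)
    where open FromSubstructure G F F∈𝒮 sub

in𝒮⇔atomic : (G : Graph (Fin n)) → ¬ Cycle G → (D : Subset n) →
  AtomicMBDCritical G D ⇔ (Σ[ G∈𝒮 ∈ In𝒮 G ] D ≐V∖ X G∈𝒮)
in𝒮⇔atomic G acyclic D = mk⇔ to from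
  where
  open GraphProperties G
  to : AtomicMBDCritical G D → Σ[ G∈𝒮 ∈ In𝒮 G ] D ≐V∖ X G∈𝒮
  to (crit , indep , no-isolated)
    with Equivalence.to (substructure⇔critical G acyclic D) crit
  ... | F , F∈𝒮 , sub , D≐ = spanning⇒In𝒮 G F all-verts all-edges F∈𝒮 , λ v → mk⇔
    (λ { v∈D (i , refl) → Equivalence.to (D≐ v) v∈D (X-π i) })
    (λ v∉X → Equivalence.from (D≐ v) λ (_ , i , eq) → v∉X (i , cong proj₁ eq))
    where
    open FromSubstructure G F F∈𝒮 sub
    ∉D⇒X : ∀ {v} → v ∉ D → XF v
    ∉D⇒X {v} v∉D = decidable-stable (X? v) (v∉D ∘ Equivalence.from (D≐ v))
    -- A vertex `v` of `D` missing from `F` has no neighbour in `X(F)`, since `F` contains all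
    -- neighbours of `X(F)`, and none in `D` by independence. It would be isolated.
    all-verts : ∀ v → v ∈ Subgraph.verts F
    all-verts v with v ∈? D
    ... | no v∉D  = proj₁ (∉D⇒X v∉D)
    ... | yes v∈D = decidable-stable (v ∈? _) λ v∉F → no-isolated v v∈D λ u v~u →
      v∉F (X-neighbour∈F (∉D⇒X λ u∈D → indep v u v∈D u∈D v~u) (~-sym v~u))
    -- By independence every edge has an end outside `D`, hence in `X(F)`, where `F` has all edges
    -- of `G`.
    all-edges : ∀ {u v} → u ~ v → T (adj (Subgraph.edges F) u v)
    all-edges {u} {v} u~v with u ∈? D
    ... | no u∉D  = X-edge (∉D⇒X u∉D) u~v
    ... | yes u∈D = subst T (Graph.adj-sym (Subgraph.edges F) v u)
      (X-edge (∉D⇒X λ v∈D → indep u v u∈D v∈D u~v) (~-sym u~v))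
  from : (Σ[ G∈𝒮 ∈ In𝒮 G ] D ≐V∖ X G∈𝒮) → AtomicMBDCritical G D
  from (G∈𝒮 , D≐) =
    Equivalence.from (substructure⇔critical G acyclic D)
      ( whole G , In𝒮⇒whole G G∈𝒮 , (λ _ _ → refl) , λ v → mk⇔
        (λ v∈D (_ , i , eq) → ∉X v∈D (i , cong proj₁ eq))
        (λ v∉X → Equivalence.from (D≐ v) λ { (i , refl) → v∉X (∈⊤ , i , refl) }) )
    , (λ u v u∈D v∈D → outside-X-independent G G∈𝒮 (∉X u∈D) (∉X v∈D))
    , (λ v v∈D → outside-X-not-isolated G G∈𝒮 (∉X v∈D))
    where
    ∉X : ∀ {v} → v ∈ D → ¬ X G∈𝒮 v
    ∉X {v} = Equivalence.to (D≐ v)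

theorem4p6 : ∀ {n} (T : Graph (Fin n)) → IsTree T → (D : Subset n) →
    (MBDCritical T D ⇔
    (Σ[ F ∈ Subgraph T ] Σ[ F∈𝒮 ∈ In𝒮 (Subgraph.toGraph F) ]
    (IsSubstructure T F F∈𝒮 × D ≐V∖ XIn F F∈𝒮)))
    ×
    (AtomicMBDCritical T D ⇔
    (Σ[ T∈𝒮 ∈ In𝒮 T ] D ≐V∖ X T∈𝒮))
theorem4p6 T tree D = substructure⇔critical T acyclic D , in𝒮⇔atomic T acyclic D
  where open IsTree tree using (acyclic)
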